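{- For all integers $t\ge 1$ and $k\ge 4$, $$A_2\bigl(k(t+1)+2,\,2k;\,k\bigr)=\frac{2^{k(t+1)+2}-3\cdot 2^{k}-1}{2^k-1}.$$
   Context: For a prime power $q$ and integers $1\le k\le n$, a partial $k$-spread in $\mathbb{F}_q^n$ is a set of $k$-dimensional subspaces of $\mathbb{F}_q^n$ any two of which intersect only in the zero vector. $A_q(n,2k;k)$ denotes the maximum possible number of elements of a partial $k$-spread in $\mathbb{F}_q^n$ (equivalently, the maximum size of a set of $k$-dimensional subspaces with pairwise subspace distance $\dim(U+V)-\dim(U\cap V)$ at least $2k$). -}

module Defs where

open import Data.Bool using (Bool; true; false; _xor_; _∧_)
open import Data.Nat using (ℕ; zero; suc; _+_; _*_; _∸_; _^_; _≤_; NonZero)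
open import Data.Nat.Properties using (+-suc)
open import Data.Fin using (Fin)
open import Data.Vec using (Vec; []; _∷_; zipWith; replicate; map; lookup)
open import Data.List using (List; length)
import Data.List as List
open import Data.Product using (Σ; ∃; _×_; _,_)
open import Relation.Binary.PropositionalEquality using (_≡_; _≢_; refl)

F₂^ : ℕ → Set
F₂^ n = Vec Bool n

𝟎 : ∀ {n} → F₂^ n
𝟎 = replicate _ false

_⊕_ : ∀ {n} → F₂^ n → F₂^ n → F₂^ n
_⊕_ = zipWith _xor_

_·_ : ∀ {n} → Bool → F₂^ n → F₂^ n
c · v = map (c ∧_) v

lincomb : ∀ {n k} → Vec Bool k → Vec (F₂^ n) k → F₂^ n
lincomb [] [] = 𝟎
lincomb (c ∷ cs) (b ∷ bs) = (c · b) ⊕ lincomb cs bs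

_∈span_ : ∀ {n k} → F₂^ n → Vec (F₂^ n) k → Set
v ∈span B = ∃ λ c → lincomb c B ≡ v

LinIndep : ∀ {n k} → Vec (F₂^ n) k → Set
LinIndep {k = k} B = ∀ c → lincomb c B ≡ 𝟎 → c ≡ replicate k false

-- A k-dimensional subspace of F₂ⁿ, given by a basis (k linearly independent
-- vectors); the subspace itself is the span of the basis.
record Subspace (n k : ℕ) : Set where
  constructor subspace
  field
    basis : Vec (F₂^ n) k
    indep : LinIndep basis
open Subspace public

_∈ˢ_ : ∀ {n k} → F₂^ n → Subspace n k → Set
v ∈ˢ U = v ∈span basis U

TrivialIntersection : ∀ {n k} → Subspace n k → Subspace n k → Set
TrivialIntersection U W = ∀ v → v ∈ˢ U → v ∈ˢ W → v ≡ 𝟎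

-- A partial k-spread in F₂ⁿ, given as a list of k-subspaces, any two
-- (at different positions) intersecting only in 0.  For k ≥ 1 this forces
-- the listed subspaces to be pairwise distinct, so the length of the list
-- is the number of elements of the partial spread.
IsPartialSpread : ∀ {n k} → List (Subspace n k) → Set
IsPartialSpread S =
  ∀ (i j : Fin (length S)) → i ≢ j →
    TrivialIntersection (List.lookup S i) (List.lookup S j)

-- "A₂(n, 2k; k) = m": m is the maximum size of a partial k-spread in F₂ⁿ.
A₂≡ : (n k m : ℕ) → Set
A₂≡ n k m =
  (Σ (List (Subspace n k)) λ S → IsPartialSpread S × length S ≡ m)
  × (∀ (S : List (Subspace n k)) → IsPartialSpread S → length S ≤ m)

private
  pow2-suc : ∀ j → Σ ℕ λ a → 2 ^ j ≡ suc a
  pow2-suc zero = 0 , refl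
  pow2-suc (suc j) with pow2-suc j
  ... | a , eq rewrite eq = a + suc (a + 0) , refl

pow2∸1-nonZero : ∀ k → 1 ≤ k → NonZero (2 ^ k ∸ 1)
pow2∸1-nonZero (suc j) _ with pow2-suc j
... | a , eq rewrite eq | +-suc a (a + 0) = _

module Submission where

-- Upper bound.  If the spread had one more element, there would be 4Δ + 1 holes (nonzero vectors lying in no
-- element), Δ = 2^(k-1).  Counting modulo powers of 2 shows that every subspace of codimension j contains
-- 1 modulo 2^(k-j) holes.  By averaging, some hyperplane contains less than half of the holes, and again
-- inside this hyperplane, and so on: after three steps at most Δ + 1, then 1, and finally 0 holes remain,
-- although their number is odd because k ≥ 4.
--
-- Lower bound.  If f is an irreducible polynomial over F₂ of degree m ≥ k, then the subspaces
-- {(c, c a mod f) : deg c < k} of F₂^(k+m), one for each a of degree < m, intersect trivially, and they all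
-- avoid 0 × F₂^m, where a spread of F₂^m can be inserted.
--
-- Existence of f.  The product D j of all monic polynomials of degree j satisfies D j = Q j · D (j-1)² with
-- Q j = x^(2^j) + x (Carlitz).  Hence the irreducible factors of Q j have degree ≤ j, and those of degree
-- d < j divide Q d.  As Q j has derivative 1, it is squarefree; comparing its degree with that of
-- Q 1 ⋯ Q (j-1), there must be a factor of degree j.

open import Defs
open import Algebra.Bundles using (CommutativeRing)
import Algebra.Properties.CommutativeSemigroup as CommSemigroup
import Algebra.Solver.Ring.Simple
open import Algebra.Solver.Ring.AlmostCommutativeRing using (fromCommutativeRing)
open import Data.Bool using (Bool; true; false; not; _xor_; _∧_; if_then_else_)
open import Data.Bool.Properties as 𝔹 using (xor-assoc; xor-comm; xor-same; xor-identityˡ; xor-identityʳ)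
open import Data.Empty using (⊥; ⊥-elim)
open import Data.Fin using (zero; suc)
open import Data.List as List using (List; []; _∷_; length)
import Data.List.Properties as List
open import Data.List.Membership.Propositional.Properties using (∈-lookup)
open import Data.List.Relation.Unary.All as All using (All; []; _∷_)
import Data.List.Relation.Unary.All.Properties as All
open import Data.List.Relation.Unary.AllPairs as AllPairs using (AllPairs; []; _∷_)
import Data.List.Relation.Unary.AllPairs.Properties as AllPairs
open import Data.Nat hiding (⌊_/2⌋)
open import Data.Nat.Divisibility using (_∣_; divides; ∣-trans; ∣-reflexive; _∣0; n∣m*n; m∣m*n; *-cancelˡ-∣; ∣m∣n⇒∣m+n)
open import Data.Nat.DivMod using (m≡m%n+[m/n]*n; m<n⇒m%n≡m; %-remove-+ʳ; m*n/n≡m)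
open import Data.Nat.Induction using (<-rec)
open import Data.Nat.Properties
open import Data.Nat.Tactic.RingSolver using (solve-∀)
open import Data.Product using (Σ; ∃; ∃₂; _×_; _,_; proj₁; proj₂)
open import Data.Sum using (_⊎_; inj₁; inj₂; [_,_]′)
open import Data.Vec as Vec using (Vec; []; _∷_; replicate; zipWith; _++_)
import Data.Vec.Properties as Vec
open import Function using (_∘_; case_of_)
open import Relation.Binary.PropositionalEquality hiding ([_])
open import Relation.Nullary using (Dec; yes; no; ¬_; _×-dec_)
open import Relation.Unary using (Decidable)

private variable
  n k m : ℕ

-- Vectors over F₂

any? : ∀ {p} {P : F₂^ n → Set p} → Decidable P → Dec (∃ P)
any? {zero} P? with P? []
... | yes p = yes ([] , p)
... | no ¬p = no λ { ([] , p) → ¬p p }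
any? {suc n} P? with any? (P? ∘ (false ∷_)) | any? (P? ∘ (true ∷_))
... | yes (v , p) | _ = yes (false ∷ v , p)
... | no _ | yes (v , p) = yes (true ∷ v , p)
... | no ¬p | no ¬q = no λ { (false ∷ v , p) → ¬p (v , p) ; (true ∷ v , p) → ¬q (v , p) }

_≟ᵛ_ : (u v : F₂^ n) → Dec (u ≡ v)
_≟ᵛ_ = Vec.≡-dec 𝔹._≟_

⊕-identityˡ : (v : F₂^ n) → 𝟎 ⊕ v ≡ v
⊕-identityˡ = Vec.zipWith-identityˡ xor-identityˡ

⊕-identityʳ : (v : F₂^ n) → v ⊕ 𝟎 ≡ v
⊕-identityʳ = Vec.zipWith-identityʳ xor-identityʳ

⊕-assoc : (u v w : F₂^ n) → (u ⊕ v) ⊕ w ≡ u ⊕ (v ⊕ w)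
⊕-assoc = Vec.zipWith-assoc xor-assoc

⊕-self : (v : F₂^ n) → v ⊕ v ≡ 𝟎
⊕-self [] = refl
⊕-self (b ∷ v) = cong₂ _∷_ (xor-same b) (⊕-self v)

xor-medial : ∀ a b c d → (a xor b) xor (c xor d) ≡ (a xor c) xor (b xor d)
xor-medial = CommSemigroup.interchange (CommutativeRing.+-commutativeSemigroup 𝔹.xor-∧-commutativeRing)

⊕-medial : (u v w z : F₂^ n) → (u ⊕ v) ⊕ (w ⊕ z) ≡ (u ⊕ w) ⊕ (v ⊕ z)
⊕-medial [] [] [] [] = refl
⊕-medial (a ∷ u) (b ∷ v) (c ∷ w) (d ∷ z) = cong₂ _∷_ (xor-medial a b c d) (⊕-medial u v w z)

x⊕y≡𝟎⇒x≡y : (u v : F₂^ n) → u ⊕ v ≡ 𝟎 → u ≡ v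
x⊕y≡𝟎⇒x≡y u v eq = begin
  u           ≡⟨ ⊕-identityʳ u ⟨
  u ⊕ 𝟎       ≡⟨ cong (u ⊕_) (⊕-self v) ⟨
  u ⊕ (v ⊕ v) ≡⟨ ⊕-assoc u v v ⟨
  (u ⊕ v) ⊕ v ≡⟨ cong (_⊕ v) eq ⟩
  𝟎 ⊕ v       ≡⟨ ⊕-identityˡ v ⟩
  v           ∎
  where open ≡-Reasoning

·-zero : (v : F₂^ n) → false · v ≡ 𝟎
·-zero [] = refl
·-zero (b ∷ v) = cong (false ∷_) (·-zero v)

·-one : (v : F₂^ n) → true · v ≡ v
·-one = Vec.map-id

·-distribʳ-xor : (a b : Bool) (v : F₂^ n) → (a xor b) · v ≡ (a · v) ⊕ (b · v)
·-distribʳ-xor false b v = sym (trans (cong (_⊕ (b · v)) (·-zero v)) (⊕-identityˡ _))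
·-distribʳ-xor true false v = sym (trans (cong ((true · v) ⊕_) (·-zero v)) (⊕-identityʳ _))
·-distribʳ-xor true true v = trans (·-zero v) (sym (⊕-self _))

lincomb-⊕ : (c d : F₂^ k) (B : Vec (F₂^ n) k) → lincomb (c ⊕ d) B ≡ lincomb c B ⊕ lincomb d B
lincomb-⊕ [] [] [] = sym (⊕-self 𝟎)
lincomb-⊕ (a ∷ c) (b ∷ d) (v ∷ B) =
  trans (cong₂ _⊕_ (·-distribʳ-xor a b v) (lincomb-⊕ c d B)) (⊕-medial (a · v) (b · v) _ _)

lincomb-𝟎 : (B : Vec (F₂^ n) k) → lincomb 𝟎 B ≡ 𝟎
lincomb-𝟎 [] = refl
lincomb-𝟎 (v ∷ B) = trans (cong₂ _⊕_ (·-zero v) (lincomb-𝟎 B)) (⊕-self 𝟎)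

lincomb-injective : {B : Vec (F₂^ n) k} → LinIndep B → ∀ c d → lincomb c B ≡ lincomb d B → c ≡ d
lincomb-injective {B = B} ind c d eq =
  x⊕y≡𝟎⇒x≡y c d (ind (c ⊕ d) (trans (lincomb-⊕ c d B) (trans (cong (_⊕ lincomb d B) eq) (⊕-self _))))

-- Counting in F₂ⁿ

+-medial : ∀ a b c d → (a + b) + (c + d) ≡ (a + c) + (b + d)
+-medial = solve-∀

-- Opaque, so that unification can recover the implicit dimension from a sum.
opaque
  ∑ : (F₂^ n → ℕ) → ℕ
  ∑ {zero} f = f []
  ∑ {suc n} f = ∑ (f ∘ (false ∷_)) + ∑ (f ∘ (true ∷_))

  ∑-cong : {f g : F₂^ n → ℕ} → (∀ v → f v ≡ g v) → ∑ f ≡ ∑ g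
  ∑-cong {zero} e = e []
  ∑-cong {suc n} e = cong₂ _+_ (∑-cong (e ∘ (false ∷_))) (∑-cong (e ∘ (true ∷_)))

  ∑-+ : (f g : F₂^ n → ℕ) → ∑ (λ v → f v + g v) ≡ ∑ f + ∑ g
  ∑-+ {zero} f g = refl
  ∑-+ {suc n} f g = trans (cong₂ _+_ (∑-+ (f ∘ (false ∷_)) _) (∑-+ (f ∘ (true ∷_)) _))
    (+-medial (∑ (f ∘ (false ∷_))) _ _ _)

  ∑-*ˡ : ∀ c (f : F₂^ n → ℕ) → ∑ (λ v → c * f v) ≡ c * ∑ f
  ∑-*ˡ {zero} c f = refl
  ∑-*ˡ {suc n} c f = trans (cong₂ _+_ (∑-*ˡ c (f ∘ (false ∷_))) (∑-*ˡ c (f ∘ (true ∷_)))) (sym (*-distribˡ-+ c _ _))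

  ∑-const : ∀ c → ∑ {n} (λ _ → c) ≡ 2 ^ n * c
  ∑-const {zero} c = sym (+-identityʳ c)
  ∑-const {suc n} c rewrite ∑-const {n} c = lem (2 ^ n) c
    where
    lem : ∀ a c → a * c + a * c ≡ 2 * a * c
    lem = solve-∀

  ∑-zero : {f : F₂^ n → ℕ} → (∀ v → f v ≡ 0) → ∑ f ≡ 0
  ∑-zero {n} f≡0 = trans (∑-cong f≡0) (trans (∑-const {n} 0) (*-zeroʳ (2 ^ n)))

  ∑-swap : (f : F₂^ n → F₂^ k → ℕ) → ∑ (λ u → ∑ (f u)) ≡ ∑ (λ v → ∑ (λ u → f u v))
  ∑-swap {zero} f = refl
  ∑-swap {suc n} f =
    trans (cong₂ _+_ (∑-swap (f ∘ (false ∷_))) (∑-swap (f ∘ (true ∷_)))) (sym (∑-+ (λ v → ∑ (λ u → f (false ∷ u) v)) _))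

  ∑-shift : (w : F₂^ n) (f : F₂^ n → ℕ) → ∑ (λ v → f (v ⊕ w)) ≡ ∑ f
  ∑-shift [] f = refl
  ∑-shift (false ∷ w) f = cong₂ _+_ (∑-shift w _) (∑-shift w _)
  ∑-shift (true ∷ w) f = trans (cong₂ _+_ (∑-shift w _) (∑-shift w _)) (+-comm (∑ (f ∘ (true ∷_))) _)

  ∑-mono-≤ : {f g : F₂^ n → ℕ} → (∀ v → f v ≤ g v) → ∑ f ≤ ∑ g
  ∑-mono-≤ {zero} le = le []
  ∑-mono-≤ {suc n} le = +-mono-≤ (∑-mono-≤ (le ∘ (false ∷_))) (∑-mono-≤ (le ∘ (true ∷_)))

  ∑-mono-< : {f g : F₂^ n → ℕ} → (∀ v → f v ≤ g v) → ∀ v → f v < g v → ∑ f < ∑ g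
  ∑-mono-< {zero} le [] lt = lt
  ∑-mono-< {suc n} le (false ∷ v) lt =
    +-mono-<-≤ (∑-mono-< (le ∘ (false ∷_)) v lt) (∑-mono-≤ (le ∘ (true ∷_)))
  ∑-mono-< {suc n} le (true ∷ v) lt =
    +-mono-≤-< (∑-mono-≤ (le ∘ (false ∷_))) (∑-mono-< (le ∘ (true ∷_)) v lt)

-- If no value were below `c`, the value above `c` at `v` would push the sum strictly past
-- `2 ^ n * c`.
below-average : (g : F₂^ n → ℕ) (c : ℕ) → ∑ g ≤ 2 ^ n * c → ∀ v → c < g v → ∃ λ u → g u < c
below-average {n} g c ∑≤ v c<gv with any? (λ u → g u <? c)
... | yes found = found
... | no none = ⊥-elim (<-irrefl refl (<-≤-trans
  (subst (_< ∑ g) (∑-const {n} c) (∑-mono-< (λ u → ≮⇒≥ (λ lt → none (u , lt))) v c<gv)) ∑≤))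

⟦_⟧ : Bool → ℕ
⟦ false ⟧ = 0
⟦ true ⟧ = 1

-- Kronecker delta, given by the same recursion as `∑` so that `∑-δ` goes coordinate by coordinate.
δ : F₂^ n → F₂^ n → ℕ
δ [] [] = 1
δ (a ∷ u) (b ∷ v) = if a xor b then 0 else δ u v

opaque
  unfolding ∑

  ∑-δ : (u : F₂^ n) (g : F₂^ n → ℕ) → ∑ (λ v → g v * δ u v) ≡ g u
  ∑-δ [] g = *-identityʳ (g [])
  ∑-δ (false ∷ u) g = trans
    (cong₂ _+_ (∑-δ u (g ∘ (false ∷_))) (∑-zero (λ v → *-zeroʳ (g (true ∷ v))))) (+-identityʳ _)
  ∑-δ (true ∷ u) g =
    cong₂ _+_ (∑-zero (λ v → *-zeroʳ (g (false ∷ v)))) (∑-δ u (g ∘ (true ∷_)))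

δ-refl : (v : F₂^ n) → δ v v ≡ 1
δ-refl [] = refl
δ-refl (a ∷ v) rewrite xor-same a = δ-refl v

δ-≢ : (u v : F₂^ n) → u ≢ v → δ u v ≡ 0
δ-≢ [] [] u≢v = ⊥-elim (u≢v refl)
δ-≢ (false ∷ u) (false ∷ v) u≢v = (δ-≢ u v (u≢v ∘ cong (false ∷_)))
δ-≢ (false ∷ u) (true ∷ v) u≢v = refl
δ-≢ (true ∷ u) (false ∷ v) u≢v = refl
δ-≢ (true ∷ u) (true ∷ v) u≢v = (δ-≢ u v (u≢v ∘ cong (true ∷_)))

-- Linear functionals and the sizes of their common kernels

Additive : (F₂^ n → Bool) → Set
Additive φ = ∀ u v → φ (u ⊕ v) ≡ φ u xor φ v

additive-𝟎 : {φ : F₂^ n → Bool} → Additive φ → φ 𝟎 ≡ false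
additive-𝟎 {φ = φ} add =
  trans (cong φ (sym (⊕-self 𝟎))) (trans (add 𝟎 𝟎) (xor-same (φ 𝟎)))

-- Indicator function of the common kernel. Dependent functionals are allowed, so for additive ones
-- its codimension is at most `length φs`.
ker : List (F₂^ n → Bool) → F₂^ n → ℕ
ker [] v = 1
ker (φ ∷ φs) v = ⟦ not (φ v) ⟧ * ker φs v

ker-0∨1 : (φs : List (F₂^ n → Bool)) (v : F₂^ n) → ker φs v ≡ 0 ⊎ All (λ φ → φ v ≡ false) φs
ker-0∨1 [] v = inj₂ []
ker-0∨1 (φ ∷ φs) v with φ v in eq | ker-0∨1 φs v
... | true | _ = inj₁ refl
... | false | inj₁ z = inj₁ (trans (+-identityʳ _) z)
... | false | inj₂ a = inj₂ (eq ∷ a)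

ker-shift : {φs : List (F₂^ n → Bool)} → All Additive φs → ∀ {w} → All (λ φ → φ w ≡ false) φs →
            ∀ v → ker φs (v ⊕ w) ≡ ker φs v
ker-shift [] [] v = refl
ker-shift {φs = φ ∷ φs} (add ∷ adds) {w} (φw ∷ φsw) v = cong₂ _*_ (cong (⟦_⟧ ∘ not) (begin
  φ (v ⊕ w)       ≡⟨ add v w ⟩
  φ v xor φ w     ≡⟨ cong (φ v xor_) φw ⟩
  φ v xor false   ≡⟨ xor-identityʳ (φ v) ⟩
  φ v             ∎)) (ker-shift adds φsw v)
  where open ≡-Reasoning

ker-𝟎 : {φs : List (F₂^ n → Bool)} → All Additive φs → ker φs 𝟎 ≡ 1
ker-𝟎 [] = refl
ker-𝟎 {φs = φ ∷ _} (add ∷ adds) rewrite additive-𝟎 {φ = φ} add = trans (+-identityʳ _) (ker-𝟎 adds)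

⟦not⟧+⟦⟧ : ∀ b → ⟦ not b ⟧ + ⟦ b ⟧ ≡ 1
⟦not⟧+⟦⟧ false = refl
⟦not⟧+⟦⟧ true = refl

-- If `φ` vanishes on the common kernel of `φs`, nothing changes. Otherwise translation by a vector
-- `w` of that kernel with `φ w ≡ true` exchanges its two halves.
∑-ker-∷ : (φ : F₂^ n → Bool) (φs : List (F₂^ n → Bool)) → All Additive (φ ∷ φs) →
          ∑ (ker φs) ≡ ∑ (ker (φ ∷ φs)) ⊎ ∑ (ker φs) ≡ 2 * ∑ (ker (φ ∷ φs))
∑-ker-∷ φ φs (add ∷ adds)
  with any? (λ w → All.all? (λ ψ → ψ w 𝔹.≟ false) φs ×-dec (φ w 𝔹.≟ true))
... | no none = inj₁ (∑-cong same)
  where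
  same : ∀ v → ker φs v ≡ ⟦ not (φ v) ⟧ * ker φs v
  same v with φ v in eq | ker-0∨1 φs v
  ... | false | _ = sym (+-identityʳ _)
  ... | true | inj₁ z = z
  ... | true | inj₂ a = ⊥-elim (none (v , a , eq))
... | yes (w , φsw , φw) = inj₂ (begin
  ∑ (ker φs)                                     ≡⟨ ∑-cong split ⟩
  ∑ (λ v → ⟦ not (φ v) ⟧ * ker φs v + ⟦ φ v ⟧ * ker φs v) ≡⟨ ∑-+ _ _ ⟩
  K + ∑ (λ v → ⟦ φ v ⟧ * ker φs v)               ≡⟨ cong (K +_) (∑-shift w _) ⟨
  K + ∑ (λ v → ⟦ φ (v ⊕ w) ⟧ * ker φs (v ⊕ w))   ≡⟨ cong (K +_) (∑-cong flip) ⟩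
  K + K                                          ≡⟨ cong (K +_) (+-identityʳ K) ⟨
  2 * K                                          ∎)
  where
  open ≡-Reasoning
  K : ℕ
  K = ∑ (ker (φ ∷ φs))
  split : ∀ v → ker φs v ≡ ⟦ not (φ v) ⟧ * ker φs v + ⟦ φ v ⟧ * ker φs v
  split v = trans (sym (*-identityˡ _))
    (trans (cong (_* ker φs v) (sym (⟦not⟧+⟦⟧ (φ v)))) (*-distribʳ-+ (ker φs v) ⟦ not (φ v) ⟧ _))
  flip : ∀ v → ⟦ φ (v ⊕ w) ⟧ * ker φs (v ⊕ w) ≡ ⟦ not (φ v) ⟧ * ker φs v
  flip v = cong₂ _*_ (cong ⟦_⟧ (begin
    φ (v ⊕ w)       ≡⟨ add v w ⟩
    φ v xor φ w     ≡⟨ cong (φ v xor_) φw ⟩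
    φ v xor true    ≡⟨ xor-comm (φ v) true ⟩
    not (φ v)       ∎)) (ker-shift adds φsw v)

-- The kernel of `j` functionals is a subspace of dimension at least `n - j`. The factor `D` keeps
-- subtraction out of the exponents; each functional costs at most one factor 2, which the induction
-- provides by passing to `2 * D`.
∣-∑-ker : (φs : List (F₂^ n → Bool)) → All Additive φs → ∀ D → 2 ^ length φs * D ∣ 2 ^ n → D ∣ ∑ (ker φs)
∣-∑-ker {n} [] [] D div = subst₂ _∣_ (*-identityˡ D) (trans (sym (*-identityʳ (2 ^ n))) (sym (∑-const {n} 1))) div
∣-∑-ker {n} (φ ∷ φs) (add ∷ adds) D div
  with ∣-∑-ker φs adds (2 * D) (subst (_∣ 2 ^ n) (lem (2 ^ length φs) D) div) | ∑-ker-∷ φ φs (add ∷ adds)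
  where
  lem : ∀ a D → 2 * a * D ≡ a * (2 * D)
  lem = solve-∀
... | 2D∣ | inj₁ eq = subst (D ∣_) eq (∣-trans (n∣m*n 2) 2D∣)
... | 2D∣ | inj₂ eq = *-cancelˡ-∣ 2 (subst (2 * D ∣_) eq 2D∣)

-- Averaging over hyperplanes

⟨_,_⟩ : F₂^ n → F₂^ n → Bool
⟨ [] , [] ⟩ = false
⟨ a ∷ u , b ∷ v ⟩ = (a ∧ b) xor ⟨ u , v ⟩

⟨⟩-additive : (h : F₂^ n) → Additive ⟨ h ,_⟩
⟨⟩-additive [] [] [] = refl
⟨⟩-additive (a ∷ h) (b ∷ u) (c ∷ v) =
  trans (cong₂ _xor_ (𝔹.∧-distribˡ-xor a b c) (⟨⟩-additive h u v)) (xor-medial (a ∧ b) (a ∧ c) _ _)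

⟨𝟎,⟩ : (v : F₂^ n) → ⟨ 𝟎 , v ⟩ ≡ false
⟨𝟎,⟩ [] = refl
⟨𝟎,⟩ (b ∷ v) = ⟨𝟎,⟩ v

opaque
  unfolding ∑

  -- At the first coordinate where `v` is `true`, flipping that coordinate of `h` flips the product,
  -- so exactly half of all `h` are orthogonal to `v`.
  2*∑-⟨,v⟩ : (v : F₂^ n) → v ≢ 𝟎 → 2 * ∑ (λ h → ⟦ not ⟨ h , v ⟩ ⟧) ≡ 2 ^ n
  2*∑-⟨,v⟩ [] v≢𝟎 = ⊥-elim (v≢𝟎 refl)
  2*∑-⟨,v⟩ {suc n} (false ∷ v) v≢𝟎 = cong (2 *_) (begin
    s + s ≡⟨ cong (s +_) (+-identityʳ s) ⟨
    2 * s ≡⟨ 2*∑-⟨,v⟩ v (v≢𝟎 ∘ cong (false ∷_)) ⟩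
    2 ^ n ∎)
    where
    open ≡-Reasoning
    s : ℕ
    s = ∑ (λ h → ⟦ not ⟨ h , v ⟩ ⟧)
  2*∑-⟨,v⟩ {suc n} (true ∷ v) _ = cong (2 *_) (begin
    ∑ (λ h → ⟦ not ⟨ h , v ⟩ ⟧) + ∑ (λ h → ⟦ not (not ⟨ h , v ⟩) ⟧) ≡⟨ ∑-+ (λ h → ⟦ not ⟨ h , v ⟩ ⟧) _ ⟨
    ∑ (λ h → ⟦ not ⟨ h , v ⟩ ⟧ + ⟦ not (not ⟨ h , v ⟩) ⟧)
      ≡⟨ ∑-cong (λ h → trans (+-comm ⟦ not ⟨ h , v ⟩ ⟧ _) (⟦not⟧+⟦⟧ (not ⟨ h , v ⟩))) ⟩
    ∑ {n} (λ _ → 1) ≡⟨ ∑-const {n} 1 ⟩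
    2 ^ n * 1 ≡⟨ *-identityʳ _ ⟩
    2 ^ n ∎)
    where open ≡-Reasoning

-- By double counting, the average over all `h` of the weight of `f` orthogonal to `h` is half of
-- `∑ f`; the zero vector, orthogonal to every `h`, has weight 0. The choice `h = 𝟎` yields the full
-- weight and is above average, so some `h` is strictly below it.
exists-halving : (f : F₂^ n → ℕ) → f 𝟎 ≡ 0 → 0 < ∑ f →
                 ∃ λ h → 2 * ∑ (λ v → ⟦ not ⟨ h , v ⟩ ⟧ * f v) < ∑ f
exists-halving {n} f f𝟎≡0 0<∑f = below-average g (∑ f) (≤-reflexive total) 𝟎 above
  where
  open ≡-Reasoning
  g : F₂^ n → ℕ
  g h = 2 * ∑ (λ v → ⟦ not ⟨ h , v ⟩ ⟧ * f v)
  above : ∑ f < g 𝟎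
  above = subst (λ s → ∑ f < 2 * s)
    (∑-cong (λ v → sym (trans (cong (λ b → ⟦ not b ⟧ * f v) (⟨𝟎,⟩ v)) (*-identityˡ (f v)))))
    (m<m+n (∑ f) (subst (0 <_) (sym (+-identityʳ (∑ f))) 0<∑f))
  rearrange : ∀ x y → 2 * (x * y) ≡ y * (2 * x)
  rearrange = solve-∀
  pointwise : ∀ v → f v * (2 * ∑ (λ h → ⟦ not ⟨ h , v ⟩ ⟧)) ≡ 2 ^ n * f v
  pointwise v with v ≟ᵛ 𝟎
  ... | yes refl rewrite f𝟎≡0 = sym (*-zeroʳ (2 ^ n))
  ... | no v≢𝟎 = trans (cong (f v *_) (2*∑-⟨,v⟩ v v≢𝟎)) (*-comm (f v) _)
  total : ∑ g ≡ 2 ^ n * ∑ f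
  total = begin
    ∑ (λ h → 2 * ∑ (λ v → ⟦ not ⟨ h , v ⟩ ⟧ * f v))     ≡⟨ ∑-cong (λ h → sym (∑-*ˡ 2 _)) ⟩
    ∑ (λ h → ∑ (λ v → 2 * (⟦ not ⟨ h , v ⟩ ⟧ * f v)))   ≡⟨ ∑-swap _ ⟩
    ∑ (λ v → ∑ (λ h → 2 * (⟦ not ⟨ h , v ⟩ ⟧ * f v)))
      ≡⟨ ∑-cong (λ v → trans (∑-cong (λ h → rearrange ⟦ not ⟨ h , v ⟩ ⟧ (f v)))
                      (trans (∑-*ˡ (f v) _) (cong (f v *_) (∑-*ˡ 2 _)))) ⟩
    ∑ (λ v → f v * (2 * ∑ (λ h → ⟦ not ⟨ h , v ⟩ ⟧)))   ≡⟨ ∑-cong pointwise ⟩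
    ∑ (λ v → 2 ^ n * f v)                               ≡⟨ ∑-*ˡ (2 ^ n) f ⟩
    2 ^ n * ∑ f                                         ∎

-- Covering multiplicities and holes

span-count : Vec (F₂^ n) k → F₂^ n → ℕ
span-count B v = ∑ (λ c → δ (lincomb c B) v)

∑-span-count : (B : Vec (F₂^ n) k) (g : F₂^ n → ℕ) → ∑ (λ v → g v * span-count B v) ≡ ∑ (λ c → g (lincomb c B))
∑-span-count B g = begin
  ∑ (λ v → g v * span-count B v)                 ≡⟨ ∑-cong (λ v → sym (∑-*ˡ (g v) _)) ⟩
  ∑ (λ v → ∑ (λ c → g v * δ (lincomb c B) v))    ≡⟨ ∑-swap _ ⟩
  ∑ (λ c → ∑ (λ v → g v * δ (lincomb c B) v))    ≡⟨ ∑-cong (λ c → ∑-δ (lincomb c B) g) ⟩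
  ∑ (λ c → g (lincomb c B))                      ∎
  where open ≡-Reasoning

-- `span-count` counts coefficient vectors, which turns sums over a subspace into sums over `F₂^ k`.
-- Independence makes it an indicator function.
span-count-∈ : {B : Vec (F₂^ n) k} → LinIndep B → ∀ c → span-count B (lincomb c B) ≡ 1
span-count-∈ {B = B} ind c = trans (∑-cong same) (∑-δ c (λ _ → 1))
  where
  same : ∀ d → δ (lincomb d B) (lincomb c B) ≡ 1 * δ c d
  same d with c ≟ᵛ d
  ... | yes refl = trans (δ-refl (lincomb c B)) (sym (trans (*-identityˡ _) (δ-refl c)))
  ... | no c≢d = trans (δ-≢ _ _ (λ eq → c≢d (sym (lincomb-injective ind d c eq))))
                       (sym (trans (*-identityˡ _) (δ-≢ c d c≢d)))

span-count-∉ : (B : Vec (F₂^ n) k) {v : F₂^ n} → ¬ (v ∈span B) → span-count B v ≡ 0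
span-count-∉ B v∉ = ∑-zero (λ c → δ-≢ _ _ (λ eq → v∉ (c , eq)))

_∈span?_ : (v : F₂^ n) (B : Vec (F₂^ n) k) → Dec (v ∈span B)
v ∈span? B = any? (λ c → lincomb c B ≟ᵛ v)

cover : List (Subspace n k) → F₂^ n → ℕ
cover [] v = 0
cover (U ∷ S) v = span-count (basis U) v + cover S v

cover-𝟎 : (S : List (Subspace n k)) → cover S 𝟎 ≡ length S
cover-𝟎 [] = refl
cover-𝟎 (U ∷ S) = cong₂ _+_
  (trans (cong (span-count (basis U)) (sym (lincomb-𝟎 (basis U)))) (span-count-∈ (indep U) 𝟎)) (cover-𝟎 S)

cover-≡0 : {U : Subspace n k} {S : List (Subspace n k)} → All (TrivialIntersection U) S →
           ∀ v → v ≢ 𝟎 → v ∈ˢ U → cover S v ≡ 0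
cover-≡0 [] v v≢𝟎 v∈U = refl
cover-≡0 {U = U} {S = W ∷ _} (t ∷ ts) v v≢𝟎 v∈U = cong₂ _+_
  (span-count-∉ (basis W) (λ v∈W → v≢𝟎 (t v v∈U v∈W))) (cover-≡0 {U = U} ts v v≢𝟎 v∈U)

cover-≤1 : {S : List (Subspace n k)} → AllPairs TrivialIntersection S → ∀ v → v ≢ 𝟎 → cover S v ≤ 1
cover-≤1 [] v v≢𝟎 = z≤n
cover-≤1 {S = U ∷ S} (t ∷ ts) v v≢𝟎 with v ∈span? basis U
... | no v∉U rewrite span-count-∉ (basis U) v∉U = cover-≤1 ts v v≢𝟎
... | yes (c , refl) rewrite span-count-∈ (indep U) c | cover-≡0 {U = U} t v v≢𝟎 (c , refl) = ≤-refl

-- The zero vector is excluded by hand. Elsewhere `cover-≤1` makes the truncated subtraction exact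
-- for a partial spread.
hole : List (Subspace n k) → F₂^ n → ℕ
hole S v with v ≟ᵛ 𝟎
... | yes _ = 0
... | no _ = 1 ∸ cover S v

hole-𝟎 : (S : List (Subspace n k)) → hole S 𝟎 ≡ 0
hole-𝟎 {n} S with 𝟎 {n} ≟ᵛ 𝟎
... | yes _ = refl
... | no 𝟎≢𝟎 = ⊥-elim (𝟎≢𝟎 refl)

-- The terms with `δ 𝟎 v` account for the zero vector, which is no hole and is covered `length S`
-- times. A single equation for all `v` can then be summed against any weight.
hole-cover : {S : List (Subspace n k)} → AllPairs TrivialIntersection S → ∀ v →
             hole S v + cover S v + δ 𝟎 v ≡ 1 + length S * δ 𝟎 v
hole-cover {S = S} ps v with v ≟ᵛ 𝟎
... | yes refl rewrite δ-refl v | cover-𝟎 S = trans (+-comm (length S) 1) (cong suc (sym (*-identityʳ (length S))))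
... | no v≢𝟎 rewrite δ-≢ 𝟎 v (v≢𝟎 ∘ sym) = begin
  1 ∸ cover S v + cover S v + 0 ≡⟨ +-identityʳ _ ⟩
  1 ∸ cover S v + cover S v     ≡⟨ m∸n+n≡m (cover-≤1 ps v v≢𝟎) ⟩
  1                             ≡⟨ cong suc (*-zeroʳ (length S)) ⟨
  1 + length S * 0              ∎
  where open ≡-Reasoning

∑-hole-cover : {S : List (Subspace n k)} → AllPairs TrivialIntersection S → (g : F₂^ n → ℕ) →
  ∑ (λ v → g v * hole S v) + ∑ (λ v → g v * cover S v) + g 𝟎 ≡ ∑ g + length S * g 𝟎
∑-hole-cover {S = S} ps g = begin
  ∑ (λ v → g v * hole S v) + ∑ (λ v → g v * cover S v) + g 𝟎
    ≡⟨ cong₂ _+_ (∑-+ _ _) (∑-δ 𝟎 g) ⟨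
  ∑ (λ v → g v * hole S v + g v * cover S v) + ∑ (λ v → g v * δ 𝟎 v)
    ≡⟨ ∑-+ _ _ ⟨
  ∑ (λ v → g v * hole S v + g v * cover S v + g v * δ 𝟎 v)
    ≡⟨ ∑-cong (λ v → trans (factor (g v) (hole S v) _ _)
                    (trans (cong (g v *_) (hole-cover ps v)) (expand (g v) (length S) _))) ⟩
  ∑ (λ v → g v + length S * (g v * δ 𝟎 v))
    ≡⟨ trans (∑-+ _ _) (cong (∑ g +_) (trans (∑-*ˡ (length S) _) (cong (length S *_) (∑-δ 𝟎 g)))) ⟩
  ∑ g + length S * g 𝟎 ∎
  where
  open ≡-Reasoning
  factor : ∀ a x y z → a * x + a * y + a * z ≡ a * (x + y + z)
  factor = solve-∀
  expand : ∀ a l z → a * (1 + l * z) ≡ a + l * (a * z)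
  expand = solve-∀

∑-cover : (S : List (Subspace n k)) → ∑ (cover S) ≡ length S * 2 ^ k
∑-cover {n} [] = ∑-zero {n} (λ _ → refl)
∑-cover {n} {k} (U ∷ S) = trans (∑-+ _ _) (cong₂ _+_
  (begin
    ∑ (span-count (basis U))               ≡⟨ ∑-cong (λ v → sym (*-identityˡ _)) ⟩
    ∑ (λ v → 1 * span-count (basis U) v)   ≡⟨ ∑-span-count (basis U) (λ _ → 1) ⟩
    ∑ {k} (λ _ → 1)                        ≡⟨ ∑-const {k} 1 ⟩
    2 ^ k * 1                              ≡⟨ *-identityʳ _ ⟩
    2 ^ k                                  ∎)
  (∑-cover S))
  where open ≡-Reasoning

ker-∘ : (φs : List (F₂^ n → Bool)) (f : F₂^ k → F₂^ n) → ∀ c → ker φs (f c) ≡ ker (List.map (_∘ f) φs) c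
ker-∘ [] f c = refl
ker-∘ (φ ∷ φs) f c = cong (⟦ not (φ (f c)) ⟧ *_) (ker-∘ φs f c)

-- Inside a spread element `U` the functionals are pulled back along the coordinate map from
-- `F₂^ k`, so that each element contributes the size of a kernel in `F₂^ k`.
∣-∑-ker-cover : (φs : List (F₂^ n → Bool)) → All Additive φs → ∀ D → 2 ^ length φs * D ∣ 2 ^ k →
                (S : List (Subspace n k)) → D ∣ ∑ (λ v → ker φs v * cover S v)
∣-∑-ker-cover φs adds D div [] = subst (D ∣_) (sym (∑-zero (λ v → *-zeroʳ (ker φs v)))) (D ∣0)
∣-∑-ker-cover {n} {k} φs adds D div (U ∷ S) =
  subst (D ∣_) (sym (trans (∑-cong (λ v → *-distribˡ-+ (ker φs v) _ _)) (∑-+ _ _)))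
    (∣m∣n⇒∣m+n (subst (D ∣_) (sym eq) (∣-∑-ker ψs adds′ D
                 (subst (λ l → 2 ^ l * D ∣ 2 ^ k) (sym (List.length-map _ φs)) div)))
               (∣-∑-ker-cover φs adds D div S))
  where
  L : F₂^ k → F₂^ n
  L c = lincomb c (basis U)
  ψs : List (F₂^ k → Bool)
  ψs = List.map (_∘ L) φs
  eq : ∑ (λ v → ker φs v * span-count (basis U) v) ≡ ∑ (ker ψs)
  eq = trans (∑-span-count (basis U) (ker φs)) (∑-cong (ker-∘ φs L))
  adds′ : All Additive ψs
  adds′ = All.map⁺ (All.map (λ {φ} add u v → trans (cong φ (lincomb-⊕ u v (basis U))) (add (L u) (L v))) adds)

-- Upper bound: holes modulo powers of 2

≡1-mod : ∀ {D F x y} → 2 ≤ D → D ∣ x → D ∣ y → F + x ≡ 1 + y → ∃ λ q → F ≡ 1 + q * D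
≡1-mod {D@(suc _)} {F} {x} {y} 2≤D D∣x D∣y eq = F / D , (begin
  F                   ≡⟨ m≡m%n+[m/n]*n F D ⟩
  F % D + F / D * D   ≡⟨ cong (_+ F / D * D) rem ⟩
  1 + F / D * D       ∎)
  where
  open ≡-Reasoning
  rem : F % D ≡ 1
  rem = begin
    F % D       ≡⟨ %-remove-+ʳ F D∣x ⟨
    (F + x) % D ≡⟨ cong (_% D) eq ⟩
    (1 + y) % D ≡⟨ %-remove-+ʳ 1 D∣y ⟩
    1 % D       ≡⟨ m<n⇒m%n≡m 2≤D ⟩
    1           ∎

holes : List (Subspace n k) → List (F₂^ n → Bool) → ℕ
holes S φs = ∑ (λ v → ker φs v * hole S v)

-- In the count of `∑-hole-cover` inside the common kernel, `D` divides the size of the kernel, the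
-- total cover and `m ∸ 1`. With `m + 1` elements, a remainder of 1 is left for the holes.
holes-≡1-mod : ∀ {m} {S : List (Subspace n k)} → AllPairs TrivialIntersection S → length S ≡ suc m →
  2 ^ k ∣ m ∸ 1 → 1 ≤ m → k ≤ n → ∀ {φs} → All Additive φs → ∀ D → 2 ≤ D → 2 ^ length φs * D ∣ 2 ^ k →
  ∃ λ q → holes S φs ≡ 1 + q * D
holes-≡1-mod {n} {k} {suc m} {S} ps len 2^k∣m _ k≤n {φs} adds D 2≤D div =
  ≡1-mod 2≤D (∣-∑-ker-cover φs adds D div S)
    (∣m∣n⇒∣m+n (∣-∑-ker φs adds D (∣-trans div (m≤n⇒^∣ k≤n)))
               (∣-trans (∣-trans (n∣m*n (2 ^ length φs)) div) 2^k∣m))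
    (suc-injective (begin
      suc (holes S φs + C)           ≡⟨ +-comm 1 _ ⟩
      holes S φs + C + 1             ≡⟨ cong (holes S φs + C +_) (ker-𝟎 adds) ⟨
      holes S φs + C + ker φs 𝟎      ≡⟨ ∑-hole-cover ps (ker φs) ⟩
      K + length S * ker φs 𝟎        ≡⟨ cong (K +_) (cong₂ _*_ len (ker-𝟎 adds)) ⟩
      K + suc (suc m) * 1            ≡⟨ lem K m ⟩
      suc (1 + (K + m))              ∎))
  where
  open ≡-Reasoning
  K C : ℕ
  K = ∑ (ker φs)
  C = ∑ (λ v → ker φs v * cover S v)
  lem : ∀ K m → K + suc (suc m) * 1 ≡ suc (1 + (K + m))
  lem = solve-∀
  m≤n⇒^∣ : k ≤ n → 2 ^ k ∣ 2 ^ n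
  m≤n⇒^∣ k≤n = subst (λ j → 2 ^ k ∣ 2 ^ j) (m+[n∸m]≡n k≤n)
    (subst (2 ^ k ∣_) (sym (^-distribˡ-+-* 2 k (n ∸ k))) (m∣m*n _))

holes-∷ : ∀ (S : List (Subspace n k)) φs → 0 < holes S φs →
          ∃ λ φ → Additive φ × 2 * holes S (φ ∷ φs) < holes S φs
holes-∷ S φs 0<F with exists-halving (λ v → ker φs v * hole S v)
                     (trans (cong (ker φs 𝟎 *_) (hole-𝟎 S)) (*-zeroʳ (ker φs 𝟎))) 0<F
... | h , lt = ⟨ h ,_⟩ , ⟨⟩-additive h ,
  subst (λ s → 2 * s < holes S φs) (∑-cong (λ v → sym (*-assoc ⟦ not ⟨ h , v ⟩ ⟧ (ker φs v) (hole S v)))) lt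

-- Half of `1 + 2 * r * D` is `r * D` plus one half; a number of the form `1 + q * D` strictly below
-- that has `q` below `r`.
halving-bound : ∀ {F F′ q D r} → 2 * F < F′ → F ≡ 1 + q * D → F′ ≤ 1 + 2 * r * D → q < r
halving-bound {q = q} {D} {r} lt refl F′≤ = *-cancelʳ-< D q r (*-cancelˡ-< 2 (q * D) (r * D) (≤-pred (begin-strict
  1 + 2 * (q * D)      <⟨ n<1+n _ ⟩
  2 + 2 * (q * D)      ≡⟨ *-distribˡ-+ 2 1 (q * D) ⟨
  2 * (1 + q * D)      <⟨ ≤-trans lt F′≤ ⟩
  1 + 2 * r * D        ≡⟨ cong suc (*-assoc 2 r D) ⟩
  1 + 2 * (r * D)      ∎)))
  where open ≤-Reasoning

-- Here Δ is `8 * E`. Successive use of `halving-bound` gives `q₁ < 2`, then `q₂ < 1`, and finally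
-- `q₃ < 0`.
no-triple-halving : ∀ E {F₀ F₁ F₂ F₃ q₁ q₂ q₃} → F₀ ≡ 1 + 32 * E → 2 * F₁ < F₀ → F₁ ≡ 1 + q₁ * (8 * E) →
  2 * F₂ < F₁ → F₂ ≡ 1 + q₂ * (4 * E) → 2 * F₃ < F₂ → F₃ ≡ 1 + q₃ * (2 * E) → ⊥
no-triple-halving E {F₁ = F₁} {F₂} {_} {q₁} {q₂} {q₃} refl lt₁ eq₁ lt₂ eq₂ lt₃ eq₃ =
  n≮0 (halving-bound {q = q₃} {2 * E} {0} lt₃ eq₃ F₂≤)
  where
  open ≤-Reasoning
  lem₁ : ∀ E → 1 + 32 * E ≡ 1 + 4 * (8 * E)
  lem₁ = solve-∀
  lem₂ : ∀ E → 1 + 1 * (8 * E) ≡ 1 + 2 * (4 * E)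
  lem₂ = solve-∀
  q₁<2 : q₁ < 2
  q₁<2 = halving-bound lt₁ eq₁ (≤-reflexive (lem₁ E))
  q₂<1 : q₂ < 1
  q₂<1 = halving-bound lt₂ eq₂ (begin
    F₁                ≡⟨ eq₁ ⟩
    1 + q₁ * (8 * E)  ≤⟨ s≤s (*-monoˡ-≤ (8 * E) (≤-pred q₁<2)) ⟩
    1 + 1 * (8 * E)   ≡⟨ lem₂ E ⟩
    1 + 2 * (4 * E)   ∎)
  F₂≤ : F₂ ≤ 1
  F₂≤ = begin
    F₂                 ≡⟨ eq₂ ⟩
    1 + q₂ * (4 * E)   ≡⟨ cong (λ q → 1 + q * (4 * E)) (n<1⇒n≡0 q₂<1) ⟩
    1                  ∎

∑-holes : ∀ {S : List (Subspace n k)} → AllPairs TrivialIntersection S →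
          holes S [] + length S * 2 ^ k + 1 ≡ 2 ^ n + length S
∑-holes {n} {k} {S} ps = begin
  holes S [] + length S * 2 ^ k + 1             ≡⟨ cong (λ s → holes S [] + s + 1) (∑-cover S) ⟨
  holes S [] + ∑ (cover S) + 1                  ≡⟨ cong (λ s → holes S [] + s + 1) (∑-cong (λ v → *-identityˡ (cover S v))) ⟨
  holes S [] + ∑ (λ v → 1 * cover S v) + 1      ≡⟨ ∑-hole-cover ps (λ _ → 1) ⟩
  ∑ {n} (λ _ → 1) + length S * 1                ≡⟨ cong₂ _+_ (∑-const {n} 1) (*-identityʳ (length S)) ⟩
  2 ^ n * 1 + length S                          ≡⟨ cong (_+ length S) (*-identityʳ (2 ^ n)) ⟩
  2 ^ n + length S                              ∎
  where open ≡-Reasoning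

-- The equation on `2 ^ n + m` says, free of subtraction, that `m + 1` elements would leave
-- `1 + 2 * 2 ^ k` holes. Three functionals are then chosen one after the other, each cutting the
-- number of holes to less than half.
no-larger-spread : ∀ {m} {S : List (Subspace n k)} → 4 ≤ k → k ≤ n → 1 ≤ m → 2 ^ k ∣ m ∸ 1 →
  2 ^ n + m ≡ suc m * 2 ^ k + (1 + 2 * 2 ^ k) → AllPairs TrivialIntersection S → length S ≢ suc m
no-larger-spread {n} {suc (suc (suc (suc k)))} {m} {S} (s≤s (s≤s (s≤s (s≤s z≤n)))) k≤n 1≤m 2^k∣ eq ps len =
  case holes-∷ S [] (subst (0 <_) (sym total) z<s) of λ { (φ₁ , a₁ , lt₁) →
  case modulo (φ₁ ∷ []) (a₁ ∷ []) 8 (s≤s (s≤s z≤n)) refl of λ { (q₁ , eq₁) →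
  case holes-∷ S (φ₁ ∷ []) (subst (0 <_) (sym eq₁) z<s) of λ { (φ₂ , a₂ , lt₂) →
  case modulo (φ₂ ∷ φ₁ ∷ []) (a₂ ∷ a₁ ∷ []) 4 (s≤s (s≤s z≤n)) refl of λ { (q₂ , eq₂) →
  case holes-∷ S (φ₂ ∷ φ₁ ∷ []) (subst (0 <_) (sym eq₂) z<s) of λ { (φ₃ , a₃ , lt₃) →
  case modulo (φ₃ ∷ φ₂ ∷ φ₁ ∷ []) (a₃ ∷ a₂ ∷ a₁ ∷ []) 2 (s≤s (s≤s z≤n)) refl of λ { (q₃ , eq₃) →
  no-triple-halving E {q₁ = q₁} {q₂} {q₃} total lt₁ eq₁ lt₂ eq₂ lt₃ eq₃ }}}}}}
  where
  open ≡-Reasoning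
  -- The pattern has replaced `k` by `4 + k`, so `2 ^ k` is here the original power divided by 16.
  E : ℕ
  E = 2 ^ k
  total : holes S [] ≡ 1 + 32 * E
  total = +-cancelʳ-≡ (suc m * 2 ^ (4 + k) + 1) _ _ (begin
    holes S [] + (suc m * 2 ^ (4 + k) + 1)      ≡⟨ +-assoc (holes S []) _ 1 ⟨
    holes S [] + suc m * 2 ^ (4 + k) + 1        ≡⟨ cong (λ l → holes S [] + l * 2 ^ (4 + k) + 1) len ⟨
    holes S [] + length S * 2 ^ (4 + k) + 1     ≡⟨ ∑-holes ps ⟩
    2 ^ n + length S                            ≡⟨ cong (2 ^ n +_) len ⟩
    2 ^ n + suc m                               ≡⟨ +-suc (2 ^ n) m ⟩
    suc (2 ^ n + m)                             ≡⟨ cong suc eq ⟩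
    suc (suc m * 2 ^ (4 + k) + (1 + 2 * 2 ^ (4 + k)))   ≡⟨ lem (suc m * 2 ^ (4 + k)) E ⟩
    1 + 32 * E + (suc m * 2 ^ (4 + k) + 1)      ∎)
    where
    lem : ∀ X E → suc (X + (1 + 2 * (2 * (2 * (2 * (2 * E)))))) ≡ 1 + 32 * E + (X + 1)
    lem = solve-∀
  -- Codimension 1, 2, 3 goes with `b` equal to 8, 4, 2. The last modulus `2 * E` is still at least
  -- 2, which is where `4 ≤ k` enters.
  modulo : ∀ φs → All Additive φs → ∀ b → 2 ≤ b → 2 ^ length φs * b ≡ 16 → ∃ λ q → holes S φs ≡ 1 + q * (b * E)
  modulo φs adds b 2≤b eq₁₆ =
    holes-≡1-mod ps len 2^k∣ 1≤m k≤n adds (b * E) (*-mono-≤ 2≤b (m^n>0 2 k)) (∣-reflexive (begin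
    2 ^ length φs * (b * E)   ≡⟨ *-assoc (2 ^ length φs) b E ⟨
    2 ^ length φs * b * E     ≡⟨ cong (_* E) eq₁₆ ⟩
    16 * E                    ≡⟨ lem E ⟩
    2 ^ (4 + k)               ∎))
    where
    lem : ∀ E → 16 * E ≡ 2 * (2 * (2 * (2 * E)))
    lem = solve-∀

-- Polynomials over F₂

-- Nonzero polynomials over F₂, constant coefficient first: b ◂ p stands for b + x p.
data Monic : Set where
  one : Monic
  _◂_ : Bool → Monic → Monic

-- Leading zeros cannot be written, so equality of polynomials is `_≡_` and the ring laws need no
-- setoid.
data Poly : Set where
  0ₚ : Poly
  ⌊_⌋ : Monic → Poly

infixr 6 _◂_

cons : Bool → Poly → Poly
cons b 0ₚ = if b then ⌊ one ⌋ else 0ₚ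
cons b ⌊ p ⌋ = ⌊ b ◂ p ⌋

shift : Poly → Poly
shift = cons false

scale : Bool → Poly → Poly
scale b p = if b then p else 0ₚ

infixl 6 _⊞_ _⊞ᵐ_
infixl 7 _⊠_ _⊠ᵐ_

_⊞ᵐ_ : Monic → Monic → Poly
one ⊞ᵐ one = 0ₚ
one ⊞ᵐ (c ◂ q) = ⌊ not c ◂ q ⌋
(b ◂ p) ⊞ᵐ one = ⌊ not b ◂ p ⌋
(b ◂ p) ⊞ᵐ (c ◂ q) = cons (b xor c) (p ⊞ᵐ q)

_⊞_ : Poly → Poly → Poly
0ₚ ⊞ q = q
⌊ p ⌋ ⊞ 0ₚ = ⌊ p ⌋
⌊ p ⌋ ⊞ ⌊ q ⌋ = p ⊞ᵐ q

_⊠ᵐ_ : Monic → Poly → Poly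
one ⊠ᵐ q = q
(b ◂ p) ⊠ᵐ q = scale b q ⊞ shift (p ⊠ᵐ q)

_⊠_ : Poly → Poly → Poly
0ₚ ⊠ q = 0ₚ
⌊ p ⌋ ⊠ q = p ⊠ᵐ q

1ₚ x : Poly
1ₚ = ⌊ one ⌋
x = shift 1ₚ

-- `cons` is no constructor, since it normalises leading zeros. With this principle and `uncons`,
-- polynomials are nevertheless treated as coefficient lists.
poly-ind : (P : Poly → Set) → P 0ₚ → (∀ b p → P p → P (cons b p)) → ∀ p → P p
poly-ind P z s 0ₚ = z
poly-ind P z s ⌊ one ⌋ = s true 0ₚ z
poly-ind P z s ⌊ b ◂ p ⌋ = s b ⌊ p ⌋ (poly-ind P z s ⌊ p ⌋)

uncons : ∀ p → ∃₂ λ b q → p ≡ cons b q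
uncons 0ₚ = false , 0ₚ , refl
uncons ⌊ one ⌋ = true , 0ₚ , refl
uncons ⌊ b ◂ p ⌋ = b , ⌊ p ⌋ , refl

⊞-identityʳ : ∀ p → p ⊞ 0ₚ ≡ p
⊞-identityʳ 0ₚ = refl
⊞-identityʳ ⌊ p ⌋ = refl

cons-⊞ : ∀ a b p q → cons a p ⊞ cons b q ≡ cons (a xor b) (p ⊞ q)
cons-⊞ false b 0ₚ q = refl
cons-⊞ true false 0ₚ 0ₚ = refl
cons-⊞ true true 0ₚ 0ₚ = refl
cons-⊞ true b 0ₚ ⌊ q ⌋ = refl
cons-⊞ a false ⌊ p ⌋ 0ₚ = cong (λ c → ⌊ c ◂ p ⌋) (sym (𝔹.xor-identityʳ a))
cons-⊞ a true ⌊ p ⌋ 0ₚ = cong (λ c → ⌊ c ◂ p ⌋) (xor-comm true a)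
cons-⊞ a b ⌊ p ⌋ ⌊ q ⌋ = refl

⊞-comm : ∀ p q → p ⊞ q ≡ q ⊞ p
⊞-comm = poly-ind _ (λ q → sym (⊞-identityʳ q)) step
  where
  step : ∀ b p → (∀ q → p ⊞ q ≡ q ⊞ p) → ∀ q → cons b p ⊞ q ≡ q ⊞ cons b p
  step b p ih q with uncons q
  ... | c , q , refl = begin
    cons b p ⊞ cons c q     ≡⟨ cons-⊞ b c p q ⟩
    cons (b xor c) (p ⊞ q)  ≡⟨ cong₂ cons (xor-comm b c) (ih q) ⟩
    cons (c xor b) (q ⊞ p)  ≡⟨ cons-⊞ c b q p ⟨
    cons c q ⊞ cons b p     ∎
    where open ≡-Reasoning

⊞-assoc : ∀ p q r → (p ⊞ q) ⊞ r ≡ p ⊞ (q ⊞ r)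
⊞-assoc = poly-ind _ (λ q r → refl) step
  where
  step : ∀ b p → (∀ q r → (p ⊞ q) ⊞ r ≡ p ⊞ (q ⊞ r)) →
         ∀ q r → (cons b p ⊞ q) ⊞ r ≡ cons b p ⊞ (q ⊞ r)
  step b p ih q r with uncons q | uncons r
  ... | c , q , refl | d , r , refl = begin
    (cons b p ⊞ cons c q) ⊞ cons d r      ≡⟨ cong (_⊞ cons d r) (cons-⊞ b c p q) ⟩
    cons (b xor c) (p ⊞ q) ⊞ cons d r     ≡⟨ cons-⊞ (b xor c) d (p ⊞ q) r ⟩
    cons ((b xor c) xor d) ((p ⊞ q) ⊞ r)  ≡⟨ cong₂ cons (xor-assoc b c d) (ih q r) ⟩
    cons (b xor (c xor d)) (p ⊞ (q ⊞ r))  ≡⟨ cons-⊞ b (c xor d) p (q ⊞ r) ⟨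
    cons b p ⊞ cons (c xor d) (q ⊞ r)     ≡⟨ cong (cons b p ⊞_) (cons-⊞ c d q r) ⟨
    cons b p ⊞ (cons c q ⊞ cons d r)      ∎
    where open ≡-Reasoning

⊞-self : ∀ p → p ⊞ p ≡ 0ₚ
⊞-self = poly-ind _ refl λ b p ih → trans (cons-⊞ b b p p) (cong₂ cons (xor-same b) ih)

⊞-medial : ∀ p q r s → (p ⊞ q) ⊞ (r ⊞ s) ≡ (p ⊞ r) ⊞ (q ⊞ s)
⊞-medial p q r s = begin
  (p ⊞ q) ⊞ (r ⊞ s) ≡⟨ ⊞-assoc p q (r ⊞ s) ⟩
  p ⊞ (q ⊞ (r ⊞ s)) ≡⟨ cong (p ⊞_) (⊞-assoc q r s) ⟨
  p ⊞ ((q ⊞ r) ⊞ s) ≡⟨ cong (λ t → p ⊞ (t ⊞ s)) (⊞-comm q r) ⟩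
  p ⊞ ((r ⊞ q) ⊞ s) ≡⟨ cong (p ⊞_) (⊞-assoc r q s) ⟩
  p ⊞ (r ⊞ (q ⊞ s)) ≡⟨ ⊞-assoc p r (q ⊞ s) ⟨
  (p ⊞ r) ⊞ (q ⊞ s) ∎
  where open ≡-Reasoning

scale-⊞ : ∀ b p q → scale b (p ⊞ q) ≡ scale b p ⊞ scale b q
scale-⊞ false p q = refl
scale-⊞ true p q = refl

scale-xor : ∀ b c p → scale (b xor c) p ≡ scale b p ⊞ scale c p
scale-xor false c p = refl
scale-xor true false p = sym (⊞-identityʳ p)
scale-xor true true p = sym (⊞-self p)

scale-shift : ∀ b p → scale b (shift p) ≡ shift (scale b p)
scale-shift false p = refl
scale-shift true p = refl

scale-⊠ : ∀ b p q → scale b p ⊠ q ≡ scale b (p ⊠ q)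
scale-⊠ false p q = refl
scale-⊠ true p q = refl

shift-⊞ : ∀ p q → shift (p ⊞ q) ≡ shift p ⊞ shift q
shift-⊞ p q = sym (cons-⊞ false false p q)

cons-⊠ : ∀ b p q → cons b p ⊠ q ≡ scale b q ⊞ shift (p ⊠ q)
cons-⊠ false 0ₚ q = refl
cons-⊠ true 0ₚ q = sym (⊞-identityʳ q)
cons-⊠ b ⌊ p ⌋ q = refl

cons-scale : ∀ b p → cons b p ≡ scale b 1ₚ ⊞ shift p
cons-scale false p = refl
cons-scale true 0ₚ = refl
cons-scale true ⌊ p ⌋ = refl

⊠-identityʳ : ∀ p → p ⊠ 1ₚ ≡ p
⊠-identityʳ = poly-ind _ refl λ b p ih →
  trans (cons-⊠ b p 1ₚ) (trans (cong (λ t → scale b 1ₚ ⊞ shift t) ih) (sym (cons-scale b p)))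

⊠-distribʳ : ∀ p q r → (p ⊞ q) ⊠ r ≡ p ⊠ r ⊞ q ⊠ r
⊠-distribʳ = poly-ind _ (λ q r → refl) step
  where
  step : ∀ b p → (∀ q r → (p ⊞ q) ⊠ r ≡ p ⊠ r ⊞ q ⊠ r) →
         ∀ q r → (cons b p ⊞ q) ⊠ r ≡ cons b p ⊠ r ⊞ q ⊠ r
  step b p ih q r with uncons q
  ... | c , q , refl = begin
    (cons b p ⊞ cons c q) ⊠ r                                     ≡⟨ cong (_⊠ r) (cons-⊞ b c p q) ⟩
    cons (b xor c) (p ⊞ q) ⊠ r                                    ≡⟨ cons-⊠ (b xor c) (p ⊞ q) r ⟩
    scale (b xor c) r ⊞ shift ((p ⊞ q) ⊠ r)
      ≡⟨ cong₂ _⊞_ (scale-xor b c r) (trans (cong shift (ih q r)) (shift-⊞ (p ⊠ r) (q ⊠ r))) ⟩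
    (scale b r ⊞ scale c r) ⊞ (shift (p ⊠ r) ⊞ shift (q ⊠ r))     ≡⟨ ⊞-medial (scale b r) _ _ _ ⟩
    (scale b r ⊞ shift (p ⊠ r)) ⊞ (scale c r ⊞ shift (q ⊠ r))     ≡⟨ cong₂ _⊞_ (cons-⊠ b p r) (cons-⊠ c q r) ⟨
    cons b p ⊠ r ⊞ cons c q ⊠ r                                   ∎
    where open ≡-Reasoning

⊠-distribˡ : ∀ p q r → p ⊠ (q ⊞ r) ≡ p ⊠ q ⊞ p ⊠ r
⊠-distribˡ = poly-ind _ (λ q r → refl) λ b p ih q r → begin
  cons b p ⊠ (q ⊞ r)                                            ≡⟨ cons-⊠ b p (q ⊞ r) ⟩
  scale b (q ⊞ r) ⊞ shift (p ⊠ (q ⊞ r))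
    ≡⟨ cong₂ _⊞_ (scale-⊞ b q r) (trans (cong shift (ih q r)) (shift-⊞ (p ⊠ q) (p ⊠ r))) ⟩
  (scale b q ⊞ scale b r) ⊞ (shift (p ⊠ q) ⊞ shift (p ⊠ r))     ≡⟨ ⊞-medial (scale b q) _ _ _ ⟩
  (scale b q ⊞ shift (p ⊠ q)) ⊞ (scale b r ⊞ shift (p ⊠ r))     ≡⟨ cong₂ _⊞_ (cons-⊠ b p q) (cons-⊠ b p r) ⟨
  cons b p ⊠ q ⊞ cons b p ⊠ r                                   ∎
  where open ≡-Reasoning

⊠-zeroʳ : ∀ p → p ⊠ 0ₚ ≡ 0ₚ
⊠-zeroʳ = poly-ind _ refl step
  where
  step : ∀ b p → p ⊠ 0ₚ ≡ 0ₚ → cons b p ⊠ 0ₚ ≡ 0ₚ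
  step false p ih = trans (cons-⊠ false p 0ₚ) (cong shift ih)
  step true p ih = trans (cons-⊠ true p 0ₚ) (cong shift ih)

⊠-shift : ∀ p q → p ⊠ shift q ≡ shift (p ⊠ q)
⊠-shift = poly-ind _ (λ q → refl) λ b p ih q → begin
  cons b p ⊠ shift q                        ≡⟨ cons-⊠ b p (shift q) ⟩
  scale b (shift q) ⊞ shift (p ⊠ shift q)   ≡⟨ cong₂ _⊞_ (scale-shift b q) (cong shift (ih q)) ⟩
  shift (scale b q) ⊞ shift (shift (p ⊠ q)) ≡⟨ shift-⊞ (scale b q) _ ⟨
  shift (scale b q ⊞ shift (p ⊠ q))         ≡⟨ cong shift (cons-⊠ b p q) ⟨
  shift (cons b p ⊠ q)                      ∎
  where open ≡-Reasoning

⊠-scale : ∀ b p q → p ⊠ scale b q ≡ scale b (p ⊠ q)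
⊠-scale false p q = ⊠-zeroʳ p
⊠-scale true p q = refl

⊠-comm : ∀ p q → p ⊠ q ≡ q ⊠ p
⊠-comm = poly-ind _ (λ q → sym (⊠-zeroʳ q)) λ b p ih q → begin
  cons b p ⊠ q                     ≡⟨ cons-⊠ b p q ⟩
  scale b q ⊞ shift (p ⊠ q)        ≡⟨ cong₂ (λ s t → scale b s ⊞ shift t) (sym (⊠-identityʳ q)) (ih q) ⟩
  scale b (q ⊠ 1ₚ) ⊞ shift (q ⊠ p) ≡⟨ cong₂ _⊞_ (⊠-scale b q 1ₚ) (⊠-shift q p) ⟨
  q ⊠ scale b 1ₚ ⊞ q ⊠ shift p     ≡⟨ ⊠-distribˡ q _ _ ⟨
  q ⊠ (scale b 1ₚ ⊞ shift p)       ≡⟨ cong (q ⊠_) (cons-scale b p) ⟨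
  q ⊠ cons b p                     ∎
  where open ≡-Reasoning

⊠-assoc : ∀ p q r → (p ⊠ q) ⊠ r ≡ p ⊠ (q ⊠ r)
⊠-assoc = poly-ind _ (λ q r → refl) λ b p ih q r → begin
  (cons b p ⊠ q) ⊠ r                     ≡⟨ cong (_⊠ r) (cons-⊠ b p q) ⟩
  (scale b q ⊞ shift (p ⊠ q)) ⊠ r        ≡⟨ ⊠-distribʳ (scale b q) _ r ⟩
  scale b q ⊠ r ⊞ shift (p ⊠ q) ⊠ r      ≡⟨ cong₂ _⊞_ (scale-⊠ b q r) (cons-⊠ false (p ⊠ q) r) ⟩
  scale b (q ⊠ r) ⊞ shift ((p ⊠ q) ⊠ r)  ≡⟨ cong (λ t → scale b (q ⊠ r) ⊞ shift t) (ih q r) ⟩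
  scale b (q ⊠ r) ⊞ shift (p ⊠ (q ⊠ r))  ≡⟨ cons-⊠ b p (q ⊠ r) ⟨
  cons b p ⊠ (q ⊠ r)                     ∎
  where open ≡-Reasoning

-- In characteristic 2 negation is the identity. The ring solver takes its coefficients from this
-- ring with decidable equality, so it also cancels equal summands.
polyRing : CommutativeRing _ _
polyRing = record
  { Carrier = Poly ; _≈_ = _≡_ ; _+_ = _⊞_ ; _*_ = _⊠_ ; -_ = λ p → p ; 0# = 0ₚ ; 1# = 1ₚ
  ; isCommutativeRing = record
    { isRing = record
      { +-isAbelianGroup = record
        { isGroup = record
          { isMonoid = record
            { isSemigroup = record
              { isMagma = record { isEquivalence = isEquivalence ; ∙-cong = cong₂ _⊞_ }
              ; assoc = ⊞-assoc }
            ; identity = (λ p → refl) , ⊞-identityʳ }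
          ; inverse = ⊞-self , ⊞-self
          ; ⁻¹-cong = λ eq → eq }
        ; comm = ⊞-comm }
      ; *-cong = cong₂ _⊠_
      ; *-assoc = ⊠-assoc
      ; *-identity = (λ p → refl) , ⊠-identityʳ
      ; distrib = ⊠-distribˡ , (λ r p q → ⊠-distribʳ p q r) }
    ; *-comm = ⊠-comm } }

_≟ᵐ_ : (p q : Monic) → Dec (p ≡ q)
one ≟ᵐ one = yes refl
one ≟ᵐ (c ◂ q) = no λ ()
(b ◂ p) ≟ᵐ one = no λ ()
(b ◂ p) ≟ᵐ (c ◂ q) with b 𝔹.≟ c | p ≟ᵐ q
... | yes refl | yes refl = yes refl
... | no b≢c | _ = no λ { refl → b≢c refl }
... | _ | no p≢q = no λ { refl → p≢q refl }

_≟ₚ_ : (p q : Poly) → Dec (p ≡ q)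
0ₚ ≟ₚ 0ₚ = yes refl
0ₚ ≟ₚ ⌊ q ⌋ = no λ ()
⌊ p ⌋ ≟ₚ 0ₚ = no λ ()
⌊ p ⌋ ≟ₚ ⌊ q ⌋ with p ≟ᵐ q
... | yes refl = yes refl
... | no p≢q = no λ { refl → p≢q refl }

open Algebra.Solver.Ring.Simple (fromCommutativeRing polyRing) _≟ₚ_ using (solve; _:=_; con; _:+_; _:*_)

-- Degree and division with remainder

deg : Monic → ℕ
deg one = 0
deg (b ◂ p) = suc (deg p)

-- The degree plus one, and 0 for the zero polynomial. Thus `size r ≤ deg m` is the usual condition
-- on a remainder modulo `m`.
size : Poly → ℕ
size 0ₚ = 0
size ⌊ p ⌋ = suc (deg p)

size-cons : ∀ b p → size (cons b p) ≤ suc (size p)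
size-cons false 0ₚ = z≤n
size-cons true 0ₚ = ≤-refl
size-cons b ⌊ p ⌋ = ≤-refl

size-⊞ : ∀ p q → size (p ⊞ q) ≤ size p ⊔ size q
size-⊞ 0ₚ q = ≤-refl
size-⊞ ⌊ p ⌋ 0ₚ = ≤-refl
size-⊞ ⌊ one ⌋ ⌊ one ⌋ = z≤n
size-⊞ ⌊ one ⌋ ⌊ c ◂ q ⌋ = ≤-refl
size-⊞ ⌊ b ◂ p ⌋ ⌊ one ⌋ = ≤-refl
size-⊞ ⌊ b ◂ p ⌋ ⌊ c ◂ q ⌋ = ≤-trans (size-cons (b xor c) (p ⊞ᵐ q)) (s≤s (size-⊞ ⌊ p ⌋ ⌊ q ⌋))

size-⊞-≤ : ∀ p q → size p ≤ n → size q ≤ n → size (p ⊞ q) ≤ n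
size-⊞-≤ p q p≤ q≤ = ≤-trans (size-⊞ p q) (⊔-lub p≤ q≤)

size-⊞-< : ∀ p q → size p < size q → size (p ⊞ q) ≡ size q
size-⊞-< 0ₚ q _ = refl
size-⊞-< ⌊ one ⌋ ⌊ one ⌋ (s≤s ())
size-⊞-< ⌊ one ⌋ ⌊ c ◂ q ⌋ _ = refl
size-⊞-< ⌊ b ◂ p ⌋ ⌊ one ⌋ (s≤s ())
size-⊞-< ⌊ b ◂ p ⌋ ⌊ c ◂ q ⌋ (s≤s lt) with p ⊞ᵐ q | size-⊞-< ⌊ p ⌋ ⌊ q ⌋ lt
... | ⌊ r ⌋ | eq = cong suc eq

size-⊞-cancel : ∀ p q → deg p ≡ deg q → size (⌊ p ⌋ ⊞ ⌊ q ⌋) ≤ deg q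
size-⊞-cancel one one _ = z≤n
size-⊞-cancel (b ◂ p) (c ◂ q) eq =
  ≤-trans (size-cons (b xor c) (p ⊞ᵐ q)) (s≤s (size-⊞-cancel p q (suc-injective eq)))

-- Absence of zero divisors and additivity of the degree in one statement: the shifted product
-- always outgrows the summand `scale b ⌊ q ⌋`.
⊠-monic : ∀ p q → ∃ λ r → ⌊ p ⌋ ⊠ ⌊ q ⌋ ≡ ⌊ r ⌋ × deg r ≡ deg p + deg q
⊠-monic one q = q , refl , refl
⊠-monic (b ◂ p) q with ⊠-monic p q
... | r , eq , deg-r rewrite eq with scale b ⌊ q ⌋ ⊞ ⌊ false ◂ r ⌋ | size-⊞-< (scale b ⌊ q ⌋) ⌊ false ◂ r ⌋ (lt b)
  where
  lt : ∀ b → size (scale b ⌊ q ⌋) < size ⌊ false ◂ r ⌋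
  lt false = z<s
  lt true = s≤s (s≤s (≤-trans (m≤n+m (deg q) (deg p)) (≤-reflexive (sym deg-r))))
... | ⌊ s ⌋ | size-s = s , refl , trans (suc-injective size-s) (cong suc deg-r)

infix 4 _∣ₚ_

_∣ₚ_ : Poly → Poly → Set
p ∣ₚ q = ∃ λ s → s ⊠ p ≡ q

∣ₚ-trans : ∀ {p q r} → p ∣ₚ q → q ∣ₚ r → p ∣ₚ r
∣ₚ-trans {p} (s , refl) (t , refl) = t ⊠ s , ⊠-assoc t s p

∣ₚ-⊞ : ∀ {p q r} → p ∣ₚ q → p ∣ₚ r → p ∣ₚ q ⊞ r
∣ₚ-⊞ {p} (s , refl) (t , refl) = s ⊞ t , ⊠-distribʳ s t p

∣ₚ-⊠ˡ : ∀ {p q} r → p ∣ₚ q → p ∣ₚ r ⊠ q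
∣ₚ-⊠ˡ {p} r (s , refl) = r ⊠ s , ⊠-assoc r s p

∣ₚ-⊠ʳ : ∀ {p q} r → p ∣ₚ q → p ∣ₚ q ⊠ r
∣ₚ-⊠ʳ {p} {q} r p∣q = subst (p ∣ₚ_) (⊠-comm r q) (∣ₚ-⊠ˡ r p∣q)

∣ₚ-refl : ∀ p → p ∣ₚ p
∣ₚ-refl p = 1ₚ , refl

∣ₚ-size : ∀ p q → p ∣ₚ q → q ≢ 0ₚ → size p ≤ size q
∣ₚ-size p q (0ₚ , refl) q≢0 = ⊥-elim (q≢0 refl)
∣ₚ-size 0ₚ q (⌊ s ⌋ , refl) q≢0 = z≤n
∣ₚ-size ⌊ p ⌋ q (⌊ s ⌋ , eq) q≢0 with ⊠-monic s p
... | r , eq′ , deg-r = subst (λ t → suc (deg p) ≤ size t) (trans (sym eq′) eq)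
  (s≤s (≤-trans (m≤n+m (deg p) (deg s)) (≤-reflexive (sym deg-r))))

-- Long division from the leading coefficient down: the next coefficient is appended to the
-- remainder, which is reduced once if its degree reaches `deg m`.
divMod : ∀ t m → ∃₂ λ q r → t ≡ q ⊠ ⌊ m ⌋ ⊞ r × size r ≤ deg m
divMod t m = poly-ind (λ t → ∃₂ λ q r → t ≡ q ⊠ ⌊ m ⌋ ⊞ r × size r ≤ deg m) (0ₚ , 0ₚ , refl , z≤n) step t
  where
  step : ∀ b t → (∃₂ λ q r → t ≡ q ⊠ ⌊ m ⌋ ⊞ r × size r ≤ deg m) →
         ∃₂ λ q r → cons b t ≡ q ⊠ ⌊ m ⌋ ⊞ r × size r ≤ deg m
  step b t (q , r , t≡ , r≤) = finish (cons b r) cons≡ (≤-trans (size-cons b r) (s≤s r≤))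
    where
    open ≡-Reasoning
    cons≡ : cons b t ≡ shift q ⊠ ⌊ m ⌋ ⊞ cons b r
    cons≡ = begin
      cons b t                              ≡⟨ cong (cons b) t≡ ⟩
      cons b (q ⊠ ⌊ m ⌋ ⊞ r)                ≡⟨ cons-⊞ false b (q ⊠ ⌊ m ⌋) r ⟨
      shift (q ⊠ ⌊ m ⌋) ⊞ cons b r          ≡⟨ cong (_⊞ cons b r) (cons-⊠ false q ⌊ m ⌋) ⟨
      shift q ⊠ ⌊ m ⌋ ⊞ cons b r            ∎
    finish : ∀ r → cons b t ≡ shift q ⊠ ⌊ m ⌋ ⊞ r → size r ≤ suc (deg m) →
             ∃₂ λ q r → cons b t ≡ q ⊠ ⌊ m ⌋ ⊞ r × size r ≤ deg m
    finish 0ₚ eq _ = shift q , 0ₚ , eq , z≤n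
    finish ⌊ r ⌋ eq (s≤s r≤m) with m≤n⇒m<n∨m≡n r≤m
    ... | inj₁ r<m = shift q , ⌊ r ⌋ , eq , r<m
    -- Both leading coefficients are 1, so adding `m` lowers the degree.
    ... | inj₂ r≡m = shift q ⊞ 1ₚ , ⌊ r ⌋ ⊞ ⌊ m ⌋ ,
      trans eq (solve 3 (λ q m r → q :* m :+ r := (q :+ con 1ₚ) :* m :+ (r :+ m)) refl (shift q) ⌊ m ⌋ ⌊ r ⌋) ,
      size-⊞-cancel r m r≡m

∣ₚ-rem : ∀ {p} q {r} s → p ∣ₚ s → s ≡ q ⊠ p ⊞ r → p ∣ₚ r
∣ₚ-rem {p} q {r} s p∣s eq = subst (p ∣ₚ_)
  (trans (cong (_⊞ q ⊠ p) eq) (solve 2 (λ a r → (a :+ r) :+ a := r) refl (q ⊠ p) r))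
  (∣ₚ-⊞ p∣s (q , refl))

_∣ₚ?_ : ∀ m t → Dec (⌊ m ⌋ ∣ₚ t)
m ∣ₚ? t with divMod t m
... | q , 0ₚ , eq , _ = yes (q , sym (trans eq (⊞-identityʳ _)))
... | q , ⌊ r ⌋ , eq , r<m = no λ m∣t →
  <⇒≱ r<m (≤-pred (∣ₚ-size ⌊ m ⌋ ⌊ r ⌋ (∣ₚ-rem q t m∣t eq) λ ()))

-- Irreducible polynomials

record Irreducible (f : Monic) : Set where
  field
    deg>0 : 1 ≤ deg f
    divisor : ∀ d → ⌊ d ⌋ ∣ₚ ⌊ f ⌋ → deg d < deg f → d ≡ one
open Irreducible

-- Euclid's algorithm with a single cofactor. From `f = q r + s` and an inverse `v` of `s` modulo
-- `f`, the product `v q` is an inverse of `r`. If the remainder is zero, `r` divides `f` and is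
-- therefore `one`.
inverse : ∀ {f} → Irreducible f → ∀ r → deg r < deg f → ∃ λ v → ⌊ f ⌋ ∣ₚ v ⊠ ⌊ r ⌋ ⊞ 1ₚ
inverse {f} irr = λ r → <-rec _ go (deg r) r refl
  where
  go : ∀ d → (∀ {d′} → d′ < d → ∀ r → deg r ≡ d′ → deg r < deg f → ∃ λ v → ⌊ f ⌋ ∣ₚ v ⊠ ⌊ r ⌋ ⊞ 1ₚ) →
       ∀ r → deg r ≡ d → deg r < deg f → ∃ λ v → ⌊ f ⌋ ∣ₚ v ⊠ ⌊ r ⌋ ⊞ 1ₚ
  go d rec r refl r<f with divMod ⌊ f ⌋ r
  ... | q , 0ₚ , eq , _ with divisor irr r (q , sym (trans eq (⊞-identityʳ _))) r<f
  ...   | refl = 1ₚ , 0ₚ , refl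
  go d rec r refl r<f | q , ⌊ s ⌋ , eq , s<r with rec s<r s refl (<-trans s<r r<f)
  ...   | v , f∣ = v ⊠ q , subst (⌊ f ⌋ ∣ₚ_)
    (trans (cong (λ t → v ⊠ ⌊ s ⌋ ⊞ 1ₚ ⊞ v ⊠ t) eq)
      (solve 4 (λ v s q r → (v :* s :+ con 1ₚ) :+ v :* (q :* r :+ s) := (v :* q) :* r :+ con 1ₚ) refl v ⌊ s ⌋ q ⌊ r ⌋))
    (∣ₚ-⊞ f∣ (∣ₚ-⊠ˡ v (∣ₚ-refl ⌊ f ⌋)))

-- If the remainder `r` of `a` is nonzero, it has an inverse `v` modulo `f`, and `b` is congruent to
-- `v a b`.
euclid : ∀ {f} → Irreducible f → ∀ a b → ⌊ f ⌋ ∣ₚ a ⊠ b → ⌊ f ⌋ ∣ₚ a ⊎ ⌊ f ⌋ ∣ₚ b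
euclid {f} irr a b f∣ab with divMod a f
... | q , 0ₚ , eq , _ = inj₁ (q , sym (trans eq (⊞-identityʳ _)))
... | q , ⌊ r ⌋ , eq , r<f with inverse irr r r<f
...   | v , f∣ = inj₂ (subst (⌊ f ⌋ ∣ₚ_)
  (trans (cong (λ t → (v ⊠ ⌊ r ⌋ ⊞ 1ₚ) ⊠ b ⊞ v ⊠ (t ⊠ b) ⊞ (v ⊠ b ⊠ q) ⊠ ⌊ f ⌋) eq)
    (solve 5 (λ v r b q f → (v :* r :+ con 1ₚ) :* b :+ v :* ((q :* f :+ r) :* b) :+ (v :* b :* q) :* f := b)
      refl v ⌊ r ⌋ b q ⌊ f ⌋))
  (∣ₚ-⊞ (∣ₚ-⊞ (∣ₚ-⊠ʳ b f∣) (∣ₚ-⊠ˡ v f∣ab)) (v ⊠ b ⊠ q , refl)))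

toPoly : F₂^ n → Poly
toPoly [] = 0ₚ
toPoly (b ∷ v) = cons b (toPoly v)

size-toPoly : (v : F₂^ n) → size (toPoly v) ≤ n
size-toPoly [] = z≤n
size-toPoly (b ∷ v) = ≤-trans (size-cons b _) (s≤s (size-toPoly v))

toPoly-𝟎 : ∀ n → toPoly {n} 𝟎 ≡ 0ₚ
toPoly-𝟎 zero = refl
toPoly-𝟎 (suc n) = cong shift (toPoly-𝟎 n)

toPoly-surjective : ∀ p → size p ≤ n → ∃ λ (v : F₂^ n) → toPoly v ≡ p
toPoly-surjective {n} 0ₚ _ = 𝟎 , toPoly-𝟎 n
toPoly-surjective ⌊ one ⌋ (s≤s {n = n} _) = true ∷ 𝟎 , cong (cons true) (toPoly-𝟎 n)
toPoly-surjective ⌊ b ◂ p ⌋ (s≤s le) with toPoly-surjective ⌊ p ⌋ le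
... | v , eq = b ∷ v , cong (cons b) eq

irreducible-factor : ∀ m → 1 ≤ deg m → ∃ λ f → Irreducible f × ⌊ f ⌋ ∣ₚ ⌊ m ⌋
irreducible-factor m = <-rec _ go (deg m) m refl
  where
  Factor : Monic → Poly → Set
  Factor m 0ₚ = ⊥
  Factor m ⌊ d ⌋ = 1 ≤ deg d × ⌊ d ⌋ ∣ₚ ⌊ m ⌋
  factor? : ∀ m p → Dec (Factor m p)
  factor? m 0ₚ = no λ ()
  factor? m ⌊ d ⌋ = (1 ≤? deg d) ×-dec (d ∣ₚ? ⌊ m ⌋)
  go : ∀ l → (∀ {l′} → l′ < l → ∀ m → deg m ≡ l′ → 1 ≤ deg m → ∃ λ f → Irreducible f × ⌊ f ⌋ ∣ₚ ⌊ m ⌋) →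
       ∀ m → deg m ≡ l → 1 ≤ deg m → ∃ λ f → Irreducible f × ⌊ f ⌋ ∣ₚ ⌊ m ⌋
  -- Vectors of length `deg m` represent precisely the polynomials of degree below `deg m`, so this
  -- searches all proper divisors.
  go l rec m refl 1≤m with any? {deg m} (λ v → factor? m (toPoly v))
  ... | no none = m , record { deg>0 = 1≤m ; divisor = div } , ∣ₚ-refl ⌊ m ⌋
    where
    div : ∀ d → ⌊ d ⌋ ∣ₚ ⌊ m ⌋ → deg d < deg m → d ≡ one
    div one _ _ = refl
    div d@(_ ◂ _) d∣m d<m with toPoly-surjective ⌊ d ⌋ d<m
    ... | v , eq = ⊥-elim (none (v , subst (Factor m) (sym eq) (z<s , d∣m)))
  ... | yes (v , fac) with toPoly v | size-toPoly v
  ...   | ⌊ d ⌋ | d<m with rec d<m d refl (proj₁ fac)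
  ...     | f , irr , f∣d = f , irr , ∣ₚ-trans f∣d (proj₂ fac)

-- The formal derivative

∂ : Poly → Poly
∂ 0ₚ = 0ₚ
∂ ⌊ one ⌋ = 0ₚ
∂ ⌊ b ◂ p ⌋ = ⌊ p ⌋ ⊞ shift (∂ ⌊ p ⌋)

∂-cons : ∀ b p → ∂ (cons b p) ≡ p ⊞ shift (∂ p)
∂-cons false 0ₚ = refl
∂-cons true 0ₚ = refl
∂-cons b ⌊ p ⌋ = refl

∂-⊞ : ∀ p q → ∂ (p ⊞ q) ≡ ∂ p ⊞ ∂ q
∂-⊞ = poly-ind _ (λ q → refl) step
  where
  step : ∀ b p → (∀ q → ∂ (p ⊞ q) ≡ ∂ p ⊞ ∂ q) → ∀ q → ∂ (cons b p ⊞ q) ≡ ∂ (cons b p) ⊞ ∂ q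
  step b p ih q with uncons q
  ... | c , q , refl = begin
    ∂ (cons b p ⊞ cons c q)                     ≡⟨ cong ∂ (cons-⊞ b c p q) ⟩
    ∂ (cons (b xor c) (p ⊞ q))                  ≡⟨ ∂-cons (b xor c) (p ⊞ q) ⟩
    (p ⊞ q) ⊞ shift (∂ (p ⊞ q))                 ≡⟨ cong (p ⊞ q ⊞_) (trans (cong shift (ih q)) (shift-⊞ (∂ p) (∂ q))) ⟩
    (p ⊞ q) ⊞ (shift (∂ p) ⊞ shift (∂ q))       ≡⟨ ⊞-medial p q _ _ ⟩
    (p ⊞ shift (∂ p)) ⊞ (q ⊞ shift (∂ q))       ≡⟨ cong₂ _⊞_ (∂-cons b p) (∂-cons c q) ⟨
    ∂ (cons b p) ⊞ ∂ (cons c q)                 ∎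
    where open ≡-Reasoning

∂-scale : ∀ b p → ∂ (scale b p) ≡ scale b (∂ p)
∂-scale false p = refl
∂-scale true p = refl

∂-⊠ : ∀ p q → ∂ (p ⊠ q) ≡ ∂ p ⊠ q ⊞ p ⊠ ∂ q
∂-⊠ = poly-ind _ (λ q → refl) λ b p ih q → begin
  ∂ (cons b p ⊠ q)                                        ≡⟨ cong ∂ (cons-⊠ b p q) ⟩
  ∂ (scale b q ⊞ shift (p ⊠ q))                           ≡⟨ ∂-⊞ (scale b q) _ ⟩
  ∂ (scale b q) ⊞ ∂ (shift (p ⊠ q))                       ≡⟨ cong₂ _⊞_ (∂-scale b q) (∂-cons false (p ⊠ q)) ⟩
  scale b (∂ q) ⊞ (p ⊠ q ⊞ x ⊠ ∂ (p ⊠ q))                 ≡⟨ cong (λ t → scale b (∂ q) ⊞ (p ⊠ q ⊞ x ⊠ t)) (ih q) ⟩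
  scale b (∂ q) ⊞ (p ⊠ q ⊞ x ⊠ (∂ p ⊠ q ⊞ p ⊠ ∂ q))
    ≡⟨ solve 6 (λ s p q y p′ q′ → s :+ (p :* q :+ y :* (p′ :* q :+ p :* q′)) :=
                                  (p :+ y :* p′) :* q :+ (s :+ y :* (p :* q′)))
         refl (scale b (∂ q)) p q x (∂ p) (∂ q) ⟩
  (p ⊞ x ⊠ ∂ p) ⊠ q ⊞ (scale b (∂ q) ⊞ x ⊠ (p ⊠ ∂ q))     ≡⟨ cong₂ _⊞_ (cong (_⊠ q) (∂-cons b p)) (cons-⊠ b p (∂ q)) ⟨
  ∂ (cons b p) ⊠ q ⊞ cons b p ⊠ ∂ q                       ∎
  where open ≡-Reasoning

-- Carlitz's products of monic polynomials

x^_ : ℕ → Poly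
x^ zero = 1ₚ
x^ suc j = shift (x^ j)

-- e j T is the product of all T + g with deg g < j, so that D j is the product of all monic polynomials
-- of degree j.
e : ℕ → Poly → Poly
e zero T = T
e (suc j) T = e j T ⊠ e j T ⊞ e j (x^ j) ⊠ e j T

D : ℕ → Poly
D j = e j (x^ j)

x^2^_ : ℕ → Poly
x^2^ zero = x
x^2^ suc j = x^2^ j ⊠ x^2^ j

Q : ℕ → Poly
Q j = x^2^ j ⊞ x

-- `e j` is a linearised polynomial in `T`: it is built from squaring, which is additive in
-- characteristic 2, and multiplication by constants.
e-⊞ : ∀ j S T → e j (S ⊞ T) ≡ e j S ⊞ e j T
e-⊞ zero S T = refl
e-⊞ (suc j) S T = trans (cong (λ a → a ⊠ a ⊞ D j ⊠ a) (e-⊞ j S T))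
  (solve 3 (λ s t d → (s :+ t) :* (s :+ t) :+ d :* (s :+ t) := (s :* s :+ d :* s) :+ (t :* t :+ d :* t))
    refl (e j S) (e j T) (D j))

-- Splits the product over `g` by the coefficient of `x^ j`. With additivity this explains the
-- recursion defining `e`.
e-suc : ∀ j T → e (suc j) T ≡ e j (T ⊞ x^ j) ⊠ e j T
e-suc j T = trans (sym (⊠-distribʳ (e j T) (D j) (e j T))) (cong (_⊠ e j T) (sym (e-⊞ j T (x^ j))))

-- Induction step of `e-shift`, for `y = x`, `s = x^2^ suc j`, `d = D j` and `g = e j T`; then `f`
-- is `e (suc j) T` and `d′` is `D (suc j)`.
e-shift-identity : ∀ y s d g →
  let f = g ⊠ g ⊞ d ⊠ g
      E = y ⊠ f ⊞ (s ⊞ y) ⊠ (g ⊠ g)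
      d′ = (s ⊞ y) ⊠ (d ⊠ d)
  in E ⊠ E ⊞ d′ ⊠ E ≡ y ⊠ (f ⊠ f ⊞ d′ ⊠ f) ⊞ (s ⊠ s ⊞ y) ⊠ (f ⊠ f)
e-shift-identity = solve 4 (λ y s d g →
  let f = g :* g :+ d :* g
      E = y :* f :+ (s :+ y) :* (g :* g)
      d′ = (s :+ y) :* (d :* d)
  in E :* E :+ d′ :* E := y :* (f :* f :+ d′ :* f) :+ (s :* s :+ y) :* (f :* f)) refl

e-shift-zero : ∀ y t → (y ⊠ t) ⊠ (y ⊠ t) ⊞ y ⊠ t ≡ y ⊠ (t ⊠ t ⊞ t) ⊞ (y ⊠ y ⊞ y) ⊠ (t ⊠ t)
e-shift-zero = solve 2 (λ y t → (y :* t) :* (y :* t) :+ y :* t := y :* (t :* t :+ t) :+ (y :* y :+ y) :* (t :* t)) refl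

D-suc-identity : ∀ y d q → y ⊠ (d ⊠ d ⊞ d ⊠ d) ⊞ q ⊠ (d ⊠ d) ≡ q ⊠ (d ⊠ d)
D-suc-identity = solve 3 (λ y d q → y :* (d :* d :+ d :* d) :+ q :* (d :* d) := q :* (d :* d)) refl

mutual
  -- Measures how far `e (suc j)` is from commuting with multiplication by `x`. For `T = x^ j` the
  -- first summand vanishes, as `x^ j` is a root of `e (suc j)`; this gives `D-suc`, which the next
  -- stage of `e-shift` uses in turn.
  e-shift : ∀ j T → e (suc j) (x ⊠ T) ≡ x ⊠ e (suc j) T ⊞ Q (suc j) ⊠ (e j T ⊠ e j T)
  e-shift zero T = e-shift-zero x T
  e-shift (suc j) T = begin
    E ⊠ E ⊞ D (suc j) ⊠ E       ≡⟨ cong₂ (λ a d → a ⊠ a ⊞ d ⊠ a) (e-shift j T) (D-suc j) ⟩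
    E′ ⊠ E′ ⊞ (Q (suc j) ⊠ (D j ⊠ D j)) ⊠ E′
      ≡⟨ e-shift-identity x (x^2^ suc j) (D j) (e j T) ⟩
    x ⊠ (F ⊠ F ⊞ (Q (suc j) ⊠ (D j ⊠ D j)) ⊠ F) ⊞ Q (suc (suc j)) ⊠ (F ⊠ F)
      ≡⟨ cong (λ d → x ⊠ (F ⊠ F ⊞ d ⊠ F) ⊞ Q (suc (suc j)) ⊠ (F ⊠ F)) (D-suc j) ⟨
    x ⊠ (F ⊠ F ⊞ D (suc j) ⊠ F) ⊞ Q (suc (suc j)) ⊠ (F ⊠ F) ∎
    where
    open ≡-Reasoning
    E E′ F : Poly
    E = e (suc j) (x ⊠ T)
    F = e (suc j) T
    E′ = x ⊠ F ⊞ Q (suc j) ⊠ (e j T ⊠ e j T)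

  D-suc : ∀ j → D (suc j) ≡ Q (suc j) ⊠ (D j ⊠ D j)
  D-suc j = trans (e-shift j (x^ j)) (D-suc-identity x (D j) (Q (suc j)))

x^-monic : ∀ j → ∃ λ m → x^ j ≡ ⌊ m ⌋ × deg m ≡ j
x^-monic zero = one , refl , refl
x^-monic (suc j) with x^-monic j
... | m , eq , deg-m = false ◂ m , cong shift eq , cong suc deg-m

size-x^ : ∀ j → size (x^ j) ≡ suc j
size-x^ j with x^-monic j
... | m , eq , deg-m rewrite eq = cong suc deg-m

size-⊞x^ : ∀ {j} m → deg m ≡ j → size (⌊ m ⌋ ⊞ x^ j) ≤ j
size-⊞x^ {j} m refl with x^-monic j
... | l , eq , deg-l rewrite eq = ≤-trans (size-⊞-cancel m l (sym deg-l)) (≤-reflexive deg-l)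

-- By `e-suc`, a `g` of degree exactly `j` loses its leading term and belongs to the factor at
-- `T ⊞ x^ j`; every smaller `g` belongs to the factor at `T`.
⊞-∣-e : ∀ j g T → size g ≤ j → T ⊞ g ∣ₚ e j T
⊞-∣-e zero 0ₚ T _ = 1ₚ , ⊞-identityʳ T
⊞-∣-e (suc j) g T g≤ = subst (T ⊞ g ∣ₚ_) (sym (e-suc j T)) (go g g≤)
  where
  go : ∀ g → size g ≤ suc j → T ⊞ g ∣ₚ e j (T ⊞ x^ j) ⊠ e j T
  go 0ₚ _ = ∣ₚ-⊠ˡ (e j (T ⊞ x^ j)) (⊞-∣-e j 0ₚ T z≤n)
  go ⌊ m ⌋ (s≤s m≤) with m≤n⇒m<n∨m≡n m≤
  ... | inj₁ m< = ∣ₚ-⊠ˡ (e j (T ⊞ x^ j)) (⊞-∣-e j ⌊ m ⌋ T m<)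
  ... | inj₂ m≡ = ∣ₚ-⊠ʳ (e j T) (subst (_∣ₚ e j (T ⊞ x^ j))
    (solve 3 (λ t y m → (t :+ y) :+ (m :+ y) := t :+ m) refl T (x^ j) ⌊ m ⌋)
    (⊞-∣-e j (⌊ m ⌋ ⊞ x^ j) (T ⊞ x^ j) (size-⊞x^ m m≡)))

monic-∣-D : ∀ m → ⌊ m ⌋ ∣ₚ D (deg m)
monic-∣-D m = subst (_∣ₚ D (deg m)) (solve 2 (λ y m → y :+ (m :+ y) := m) refl (x^ deg m) ⌊ m ⌋)
  (⊞-∣-e (deg m) (⌊ m ⌋ ⊞ x^ deg m) (x^ deg m) (size-⊞x^ m refl))

module _ {f : Monic} (irr : Irreducible f) where

  ∣-e : ∀ j T → ⌊ f ⌋ ∣ₚ e j T → ∃ λ g → size g ≤ j × ⌊ f ⌋ ∣ₚ T ⊞ g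
  ∣-e zero T f∣ = 0ₚ , z≤n , subst (⌊ f ⌋ ∣ₚ_) (sym (⊞-identityʳ T)) f∣
  ∣-e (suc j) T f∣ with euclid irr (e j (T ⊞ x^ j)) (e j T) (subst (⌊ f ⌋ ∣ₚ_) (e-suc j T) f∣)
  ... | inj₂ f∣e = let g , g≤ , f∣g = ∣-e j T f∣e in g , m≤n⇒m≤1+n g≤ , f∣g
  ... | inj₁ f∣e = let g , g≤ , f∣g = ∣-e j (T ⊞ x^ j) f∣e in
    x^ j ⊞ g , size-⊞-≤ (x^ j) g (≤-reflexive (size-x^ j)) (m≤n⇒m≤1+n g≤) , subst (⌊ f ⌋ ∣ₚ_) (⊞-assoc T (x^ j) g) f∣g

  -- By `∣-e`, the prime `f` divides one of the factors `x^ j ⊞ g` of `D j`, each of degree `j` and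
  -- hence nonzero.
  ∣-D⇒deg≤ : ∀ j → ⌊ f ⌋ ∣ₚ D j → deg f ≤ j
  ∣-D⇒deg≤ j f∣ with ∣-e j (x^ j) f∣
  ... | g , g≤ , f∣g = ≤-pred (subst (suc (deg f) ≤_) size≡ (∣ₚ-size ⌊ f ⌋ (x^ j ⊞ g) f∣g nonzero))
    where
    size≡ : size (x^ j ⊞ g) ≡ suc j
    size≡ = trans (cong size (⊞-comm (x^ j) g))
      (trans (size-⊞-< g (x^ j) (≤-trans (s≤s g≤) (≤-reflexive (sym (size-x^ j))))) (size-x^ j))
    nonzero : x^ j ⊞ g ≢ 0ₚ
    nonzero eq = case trans (sym size≡) (cong size eq) of λ ()

  -- Squares have derivative 0, so `Q (suc j)` has derivative 1. If it equals `u f f`, its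
  -- derivative is `u′ f f`, and `f` divides 1.
  Q-squarefree : ∀ j → ¬ (⌊ f ⌋ ⊠ ⌊ f ⌋ ∣ₚ Q (suc j))
  Q-squarefree j (u , eq) = <⇒≱ (deg>0 irr) (≤-pred (∣ₚ-size ⌊ f ⌋ 1ₚ (∂ u ⊠ ⌊ f ⌋ , f∣1) λ ()))
    where
    open ≡-Reasoning
    f∣1 : ∂ u ⊠ ⌊ f ⌋ ⊠ ⌊ f ⌋ ≡ 1ₚ
    f∣1 = begin
      ∂ u ⊠ ⌊ f ⌋ ⊠ ⌊ f ⌋
        ≡⟨ solve 4 (λ u′ f f′ u → u′ :* f :* f := u′ :* (f :* f) :+ u :* (f′ :* f :+ f :* f′))
             refl (∂ u) ⌊ f ⌋ (∂ ⌊ f ⌋) u ⟩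
      ∂ u ⊠ (⌊ f ⌋ ⊠ ⌊ f ⌋) ⊞ u ⊠ (∂ ⌊ f ⌋ ⊠ ⌊ f ⌋ ⊞ ⌊ f ⌋ ⊠ ∂ ⌊ f ⌋)
        ≡⟨ cong (λ t → ∂ u ⊠ (⌊ f ⌋ ⊠ ⌊ f ⌋) ⊞ u ⊠ t) (∂-⊠ ⌊ f ⌋ ⌊ f ⌋) ⟨
      ∂ u ⊠ (⌊ f ⌋ ⊠ ⌊ f ⌋) ⊞ u ⊠ ∂ (⌊ f ⌋ ⊠ ⌊ f ⌋)    ≡⟨ ∂-⊠ u (⌊ f ⌋ ⊠ ⌊ f ⌋) ⟨
      ∂ (u ⊠ (⌊ f ⌋ ⊠ ⌊ f ⌋))                          ≡⟨ cong ∂ eq ⟩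
      ∂ (x^2^ j ⊠ x^2^ j ⊞ x)                          ≡⟨ ∂-⊞ (x^2^ j ⊠ x^2^ j) x ⟩
      ∂ (x^2^ j ⊠ x^2^ j) ⊞ 1ₚ                         ≡⟨ cong (_⊞ 1ₚ) (∂-⊠ (x^2^ j) (x^2^ j)) ⟩
      ∂ (x^2^ j) ⊠ x^2^ j ⊞ x^2^ j ⊠ ∂ (x^2^ j) ⊞ 1ₚ
        ≡⟨ solve 2 (λ y y′ → y′ :* y :+ y :* y′ :+ con 1ₚ := con 1ₚ) refl (x^2^ j) (∂ (x^2^ j)) ⟩
      1ₚ                                               ∎

-- An irreducible factor `f` of `m = h f` that divides `M` is split off. By induction `M = t h`, and
-- `f` divides `t` or `h`: in the first case `m` divides `M`, in the second `f f` divides `m`.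
squarefree-∣ : ∀ M m → (∀ {f} → Irreducible f → ¬ (⌊ f ⌋ ⊠ ⌊ f ⌋ ∣ₚ ⌊ m ⌋)) →
               ⌊ m ⌋ ∣ₚ M ⊎ ∃ λ f → Irreducible f × ⌊ f ⌋ ∣ₚ ⌊ m ⌋ × ¬ (⌊ f ⌋ ∣ₚ M)
squarefree-∣ M m = <-rec _ go (deg m) m refl
  where
  Goal : Monic → Set
  Goal m = (∀ {f} → Irreducible f → ¬ (⌊ f ⌋ ⊠ ⌊ f ⌋ ∣ₚ ⌊ m ⌋)) →
           ⌊ m ⌋ ∣ₚ M ⊎ ∃ λ f → Irreducible f × ⌊ f ⌋ ∣ₚ ⌊ m ⌋ × ¬ (⌊ f ⌋ ∣ₚ M)
  go : ∀ l → (∀ {l′} → l′ < l → ∀ m → deg m ≡ l′ → Goal m) → ∀ m → deg m ≡ l → Goal m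
  go l rec one _ sqf = inj₁ (M , ⊠-identityʳ M)
  go l rec m@(_ ◂ _) refl sqf with irreducible-factor m (s≤s z≤n)
  ... | f , irr , f∣m with f ∣ₚ? M
  ...   | no f∤M = inj₂ (f , irr , f∣m , f∤M)
  go l rec m@(_ ◂ _) refl sqf | f , irr , (⌊ h ⌋ , hf≡m) | yes (s , sf≡M) with ⊠-monic h f
  ... | r , hf≡r , deg-r with trans (sym hf≡r) hf≡m
  ...   | refl with rec h<m h refl (λ irr-g g²∣h → sqf irr-g (∣ₚ-trans g²∣h h∣m))
    where
    h<m : deg h < deg m
    h<m = subst (deg h <_) (sym deg-r) (m<m+n (deg h) (deg>0 irr))
    h∣m : ⌊ h ⌋ ∣ₚ ⌊ m ⌋
    h∣m = ⌊ f ⌋ , trans (⊠-comm ⌊ f ⌋ ⌊ h ⌋) hf≡m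
  ...     | inj₂ (g , irr-g , g∣h , g∤M) = inj₂ (g , irr-g , ∣ₚ-trans g∣h (⌊ f ⌋ , trans (⊠-comm ⌊ f ⌋ ⌊ h ⌋) hf≡m) , g∤M)
  ...     | inj₁ (t , th≡M) with euclid irr t ⌊ h ⌋ (s , trans sf≡M (sym th≡M))
  ...       | inj₁ (a , refl) = inj₁ (a , trans (cong (a ⊠_) (sym hf≡m))
    (trans (solve 3 (λ a h f → a :* (h :* f) := a :* f :* h) refl a ⌊ h ⌋ ⌊ f ⌋) th≡M))
  ...       | inj₂ (a , af≡h) = ⊥-elim (sqf irr (a , trans (sym (⊠-assoc a ⌊ f ⌋ ⌊ f ⌋)) (trans (cong (_⊠ ⌊ f ⌋) af≡h) hf≡m)))

-- Irreducible polynomials of every degree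

∏Q : ℕ → Poly
∏Q zero = 1ₚ
∏Q (suc n) = ∏Q n ⊠ Q (suc n)

Q-∣-∏Q : ∀ {d n} → d < n → Q (suc d) ∣ₚ ∏Q n
Q-∣-∏Q {d} {suc n} (s≤s d≤n) with m≤n⇒m<n∨m≡n d≤n
... | inj₁ d<n = ∣ₚ-⊠ʳ (Q (suc n)) (Q-∣-∏Q d<n)
... | inj₂ refl = ∣ₚ-⊠ˡ (∏Q n) (∣ₚ-refl (Q (suc n)))

x^2^-monic : ∀ j → ∃ λ m → x^2^ j ≡ ⌊ m ⌋ × deg m ≡ 2 ^ j
x^2^-monic zero = false ◂ one , refl , refl
x^2^-monic (suc j) with x^2^-monic j
... | m , eq , deg-m rewrite eq with ⊠-monic m m
...   | r , eq′ , deg-r = r , eq′ , trans deg-r (cong₂ _+_ deg-m (trans deg-m (sym (+-identityʳ _))))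

-- The index starts at 1 because `Q 0` is `x ⊞ x`, which is zero.
Q-monic : ∀ j → ∃ λ m → Q (suc j) ≡ ⌊ m ⌋ × deg m ≡ 2 ^ suc j
Q-monic j with x^2^-monic (suc j)
... | l , eq , deg-l with Q (suc j) | size≡
  where
  size≡ : size (Q (suc j)) ≡ suc (2 ^ suc j)
  size≡ = begin
    size (x^2^ suc j ⊞ x)   ≡⟨ cong size (trans (cong (_⊞ x) eq) (⊞-comm ⌊ l ⌋ x)) ⟩
    size (x ⊞ ⌊ l ⌋)        ≡⟨ size-⊞-< x ⌊ l ⌋ (s≤s (subst (2 ≤_) (sym deg-l) (*-monoʳ-≤ 2 (m^n>0 2 j)))) ⟩
    suc (deg l)             ≡⟨ cong suc deg-l ⟩
    suc (2 ^ suc j)         ∎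
    where open ≡-Reasoning
... | ⌊ m ⌋ | size≡ = m , refl , suc-injective size≡

-- The degree 2 + 4 + ... + 2^n is 2 less than the degree of `Q (suc n)`.
∏Q-monic : ∀ n → ∃ λ m → ∏Q n ≡ ⌊ m ⌋ × 2 + deg m ≡ 2 ^ suc n
∏Q-monic zero = one , refl , refl
∏Q-monic (suc n) with ∏Q-monic n | Q-monic n
... | m , eq , deg-m | q , eq′ , deg-q rewrite eq | eq′ with ⊠-monic m q
...   | r , eq″ , deg-r = r , eq″ , trans (cong (2 +_) deg-r)
  (cong₂ _+_ deg-m (trans deg-q (sym (+-identityʳ _))))

Q∣D : ∀ j → Q (suc j) ∣ₚ D (suc j)
Q∣D j = D j ⊠ D j , trans (⊠-comm (D j ⊠ D j) (Q (suc j))) (sym (D-suc j))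

-- f divides D (deg f) = Q (deg f) · D (deg f - 1)².
irreducible-∣-Q : ∀ {f} d → Irreducible f → deg f ≡ suc d → ⌊ f ⌋ ∣ₚ Q (suc d)
irreducible-∣-Q {f} d irr deg-f = [ (λ f∣Q → f∣Q) , ⊥-elim ∘ f∤D² ]′ (euclid irr (Q (suc d)) (D d ⊠ D d) f∣QD²)
  where
  f∣QD² : ⌊ f ⌋ ∣ₚ Q (suc d) ⊠ (D d ⊠ D d)
  f∣QD² = subst (⌊ f ⌋ ∣ₚ_) (trans (cong D deg-f) (D-suc d)) (monic-∣-D f)
  f∤D : ¬ (⌊ f ⌋ ∣ₚ D d)
  f∤D f∣D = <⇒≱ (≤-reflexive (sym deg-f)) (∣-D⇒deg≤ irr d f∣D)
  f∤D² : ¬ (⌊ f ⌋ ∣ₚ D d ⊠ D d)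
  f∤D² f∣D² = [ f∤D , f∤D ]′ (euclid irr (D d) (D d) f∣D²)

-- The degree is at most `suc n` because `Q (suc n)` divides `D (suc n)`. If it were some smaller
-- `d`, then `f` would divide `Q d` and with it `∏Q n`.
∣-Q⇒deg : ∀ {f} n → Irreducible f → ⌊ f ⌋ ∣ₚ Q (suc n) → ¬ (⌊ f ⌋ ∣ₚ ∏Q n) → deg f ≡ suc n
∣-Q⇒deg {f} n irr f∣Q f∤∏ =
  ≤-antisym (∣-D⇒deg≤ irr (suc n) (∣ₚ-trans f∣Q (Q∣D n))) (≮⇒≥ λ f<n → small (deg f) refl (deg>0 irr) (≤-pred f<n))
  where
  small : ∀ d → deg f ≡ d → 1 ≤ d → d ≤ n → ⊥
  small (suc d) deg-f _ d<n = f∤∏ (∣ₚ-trans (irreducible-∣-Q d irr deg-f) (Q-∣-∏Q d<n))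

-- By its degree, `Q (suc n)` cannot divide `∏Q n`. As it is squarefree, one of its irreducible
-- factors does not divide `∏Q n`, and that factor has the required degree.
exists-irreducible : ∀ n → ∃ λ f → Irreducible f × deg f ≡ suc n
exists-irreducible n = go (Q-monic n) (∏Q-monic n)
  where
  go : (∃ λ m → Q (suc n) ≡ ⌊ m ⌋ × deg m ≡ 2 ^ suc n) → (∃ λ m → ∏Q n ≡ ⌊ m ⌋ × 2 + deg m ≡ 2 ^ suc n) →
       ∃ λ f → Irreducible f × deg f ≡ suc n
  go (q , Q≡ , deg-q) (m , ∏≡ , deg-m) =
    [ (λ q∣∏ → ⊥-elim (<⇒≱ m<q (≤-pred (∣ₚ-size ⌊ q ⌋ ⌊ m ⌋ (subst (⌊ q ⌋ ∣ₚ_) ∏≡ q∣∏) λ ()))))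
    , (λ { (f , irr , f∣q , f∤∏) → f , irr , ∣-Q⇒deg n irr (subst (⌊ f ⌋ ∣ₚ_) (sym Q≡) f∣q) f∤∏ })
    ]′ (squarefree-∣ (∏Q n) q λ {f} irr → subst (λ t → ¬ (⌊ f ⌋ ⊠ ⌊ f ⌋ ∣ₚ t)) Q≡ (Q-squarefree irr n))
    where
    m<q : deg m < deg q
    m<q = subst (deg m <_) (trans deg-m (sym deg-q)) (m≤n⇒m≤1+n ≤-refl)

-- Spreads from multiplication modulo an irreducible polynomial

toPoly-⊕ : (u v : F₂^ n) → toPoly (u ⊕ v) ≡ toPoly u ⊞ toPoly v
toPoly-⊕ [] [] = refl
toPoly-⊕ (a ∷ u) (b ∷ v) = trans (cong (cons (a xor b)) (toPoly-⊕ u v)) (sym (cons-⊞ a b (toPoly u) (toPoly v)))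

toPoly-· : ∀ b (v : F₂^ n) → toPoly (b · v) ≡ scale b (toPoly v)
toPoly-· {n} false v = trans (cong toPoly (·-zero v)) (toPoly-𝟎 n)
toPoly-· true v = cong toPoly (·-one v)

toPoly≡0⇒≡𝟎 : (v : F₂^ n) → toPoly v ≡ 0ₚ → v ≡ 𝟎
toPoly≡0⇒≡𝟎 [] _ = refl
toPoly≡0⇒≡𝟎 (b ∷ v) eq with toPoly v in toPoly-v
toPoly≡0⇒≡𝟎 (false ∷ v) eq | 0ₚ = cong (false ∷_) (toPoly≡0⇒≡𝟎 v toPoly-v)

module _ {f : Monic} (irr : Irreducible f) (deg-f : deg f ≡ m) where

  ∣-toPoly⇒≡𝟎 : k ≤ m → (v : F₂^ k) → ⌊ f ⌋ ∣ₚ toPoly v → v ≡ 𝟎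
  ∣-toPoly⇒≡𝟎 k≤m v f∣v with toPoly v ≟ₚ 0ₚ
  ... | yes eq = toPoly≡0⇒≡𝟎 v eq
  ... | no v≢0 = ⊥-elim (<⇒≱ (s≤s (≤-trans (size-toPoly v) (≤-trans k≤m (≤-reflexive (sym deg-f)))))
                             (∣ₚ-size ⌊ f ⌋ (toPoly v) f∣v v≢0))

  times-x : (v : F₂^ m) → ∃ λ (w : F₂^ m) → ⌊ f ⌋ ∣ₚ x ⊠ toPoly v ⊞ toPoly w
  times-x v with divMod (x ⊠ toPoly v) f
  ... | q , r , eq , r≤ with toPoly-surjective r (≤-trans r≤ (≤-reflexive deg-f))
  ...   | w , refl = w , q , sym (trans (cong (_⊞ toPoly w) eq)
    (solve 2 (λ a b → (a :+ b) :+ b := a) refl (q ⊠ ⌊ f ⌋) (toPoly w)))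

  -- The residues of `a`, `x a`, `x² a`, ... modulo `f`: the rows of the matrix of `c ↦ c a mod f`
  -- on polynomials of degree below `k`.
  powers : ∀ k → F₂^ m → Vec (F₂^ m) k
  powers zero a = []
  powers (suc k) a = a ∷ powers k (proj₁ (times-x a))

  -- Horner's rule `(b + x c) a = b a + c (x a)`, where `x a` is replaced by its residue `a′`.
  lincomb-powers : (c : F₂^ k) (a : F₂^ m) →
                   ⌊ f ⌋ ∣ₚ toPoly (lincomb c (powers k a)) ⊞ toPoly c ⊠ toPoly a
  lincomb-powers [] a = 0ₚ , sym (trans (⊞-identityʳ _) (toPoly-𝟎 m))
  lincomb-powers {suc k} (b ∷ c) a = subst (⌊ f ⌋ ∣ₚ_) (sym (begin
    toPoly ((b · a) ⊕ lincomb c (powers k a′)) ⊞ cons b C ⊠ A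
      ≡⟨ cong₂ _⊞_ (trans (toPoly-⊕ (b · a) _) (cong (_⊞ L) (toPoly-· b a))) (cons-⊠ b C A) ⟩
    (scale b A ⊞ L) ⊞ (scale b A ⊞ x ⊠ (C ⊠ A))
      ≡⟨ identity (scale b A) L x C A (toPoly a′) ⟩
    (L ⊞ C ⊠ toPoly a′) ⊞ C ⊠ (x ⊠ A ⊞ toPoly a′)   ∎))
    (∣ₚ-⊞ (lincomb-powers c a′) (∣ₚ-⊠ˡ C (proj₂ (times-x a))))
    where
    open ≡-Reasoning
    a′ : F₂^ m
    a′ = proj₁ (times-x a)
    A C L : Poly
    A = toPoly a
    C = toPoly c
    L = toPoly (lincomb c (powers k a′))
    identity : ∀ s l y c a a′ → (s ⊞ l) ⊞ (s ⊞ y ⊠ (c ⊠ a)) ≡ (l ⊞ c ⊠ a′) ⊞ c ⊠ (y ⊠ a ⊞ a′)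
    identity = solve 6 (λ s l y c a a′ →
      (s :+ l) :+ (s :+ y :* (c :* a)) := (l :+ c :* a′) :+ c :* (y :* a :+ a′)) refl

  -- `f` divides `c (a + b)`, hence one of the two factors. Both have degree below `deg f`, for `c`
  -- thanks to `k ≤ m`, so that factor is zero.
  powers-separate : k ≤ m → (c : F₂^ k) (a b : F₂^ m) →
                    lincomb c (powers k a) ≡ lincomb c (powers k b) → c ≡ 𝟎 ⊎ a ≡ b
  powers-separate {k} k≤m c a b eq =
    [ inj₁ ∘ ∣-toPoly⇒≡𝟎 k≤m c , inj₂ ∘ x⊕y≡𝟎⇒x≡y a b ∘ ∣-toPoly⇒≡𝟎 ≤-refl (a ⊕ b) ]′ (euclid irr C _ f∣)
    where
    C : Poly
    C = toPoly c
    cancel : ∀ l c a b → (l ⊞ c ⊠ a) ⊞ (l ⊞ c ⊠ b) ≡ c ⊠ (a ⊞ b)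
    cancel = solve 4 (λ l c a b → (l :+ c :* a) :+ (l :+ c :* b) := c :* (a :+ b)) refl
    f∣ : ⌊ f ⌋ ∣ₚ C ⊠ toPoly (a ⊕ b)
    f∣ = subst (⌊ f ⌋ ∣ₚ_)
      (trans (cancel (toPoly (lincomb c (powers k b))) C (toPoly a) (toPoly b)) (cong (C ⊠_) (sym (toPoly-⊕ a b))))
      (∣ₚ-⊞ (subst (λ l → ⌊ f ⌋ ∣ₚ toPoly l ⊞ C ⊠ toPoly a) eq (lincomb-powers c a)) (lincomb-powers c b))

-- Subspaces as graphs of linear maps

𝟎-++ : ∀ k → 𝟎 {k} ++ 𝟎 {m} ≡ 𝟎
𝟎-++ zero = refl
𝟎-++ (suc k) = cong (false ∷_) (𝟎-++ k)

lincomb-++ : ∀ {j} (c : F₂^ j) (A : Vec (F₂^ k) j) (B : Vec (F₂^ m) j) →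
             lincomb c (zipWith _++_ A B) ≡ lincomb c A ++ lincomb c B
lincomb-++ {k} [] [] [] = sym (𝟎-++ k)
lincomb-++ (b ∷ c) (u ∷ A) (v ∷ B) =
  trans (cong₂ _⊕_ (Vec.map-++ _ u v) (lincomb-++ c A B)) (Vec.zipWith-++ _xor_ (b · u) (b · v) _ _)

unit-vectors : ∀ k → Vec (F₂^ k) k
unit-vectors zero = []
unit-vectors (suc k) = (true ∷ 𝟎) ∷ Vec.map (false ∷_) (unit-vectors k)

lincomb-false∷ : ∀ {j} (c : F₂^ j) (B : Vec (F₂^ m) j) → lincomb c (Vec.map (false ∷_) B) ≡ false ∷ lincomb c B
lincomb-false∷ [] [] = refl
lincomb-false∷ (false ∷ c) (v ∷ B) = cong (_ ⊕_) (lincomb-false∷ c B)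
lincomb-false∷ (true ∷ c) (v ∷ B) = cong (_ ⊕_) (lincomb-false∷ c B)

·-𝟎 : ∀ b → b · 𝟎 {n} ≡ 𝟎
·-𝟎 false = ·-zero 𝟎
·-𝟎 true = ·-one 𝟎

lincomb-unit-vectors : (c : F₂^ k) → lincomb c (unit-vectors k) ≡ c
lincomb-unit-vectors [] = refl
lincomb-unit-vectors {suc k} (b ∷ c) = trans (cong ((b · (true ∷ 𝟎)) ⊕_) (lincomb-false∷ c (unit-vectors k)))
  (cong₂ _∷_ (first b) (trans (cong₂ _⊕_ (·-𝟎 b) (lincomb-unit-vectors c)) (⊕-identityˡ c)))
  where
  first : ∀ b → (b ∧ true) xor false ≡ b
  first false = refl
  first true = refl

lincomb-replicate-𝟎 : (c : F₂^ k) → lincomb c (replicate k (𝟎 {n})) ≡ 𝟎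
lincomb-replicate-𝟎 [] = refl
lincomb-replicate-𝟎 (b ∷ c) = trans (cong₂ _⊕_ (·-𝟎 b) (lincomb-replicate-𝟎 c)) (⊕-self 𝟎)

-- The row space of the block matrix `(I | B)`. The identity block gives independence for every `B`.
graph : Vec (F₂^ m) k → Subspace (k + m) k
graph {k = k} B = subspace (zipWith _++_ (unit-vectors k) B) λ c eq →
  trans (sym (lincomb-unit-vectors c))
    (Vec.++-injectiveˡ _ _ (trans (sym (lincomb-++ c (unit-vectors k) B)) (trans eq (sym (𝟎-++ k)))))

∈-graph : (B : Vec (F₂^ m) k) {v : F₂^ (k + m)} → v ∈ˢ graph B → ∃ λ c → v ≡ c ++ lincomb c B
∈-graph {k = k} B (c , refl) =
  c , trans (lincomb-++ c (unit-vectors k) B) (cong (_++ lincomb c B) (lincomb-unit-vectors c))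

lincomb-𝟎++ : (c : F₂^ k) (B : Vec (F₂^ m) k) → lincomb c (zipWith _++_ (replicate k (𝟎 {n})) B) ≡ 𝟎 {n} ++ lincomb c B
lincomb-𝟎++ {k} c B = trans (lincomb-++ c (replicate k 𝟎) B) (cong (_++ lincomb c B) (lincomb-replicate-𝟎 c))

embed : Subspace m k → Subspace (n + m) k
embed {m} {k} {n} U = subspace (zipWith _++_ (replicate k 𝟎) (basis U)) λ c eq →
  indep U c (Vec.++-injectiveʳ (𝟎 {n}) 𝟎 (trans (sym (lincomb-𝟎++ c (basis U))) (trans eq (sym (𝟎-++ n)))))

∈-embed : (U : Subspace m k) {v : F₂^ (n + m)} → v ∈ˢ embed {n = n} U → ∃ λ w → w ∈ˢ U × v ≡ 𝟎 {n} ++ w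
∈-embed U (c , refl) = lincomb c (basis U) , (c , refl) , lincomb-𝟎++ c (basis U)

embed-trivial : {U W : Subspace m k} → TrivialIntersection U W → TrivialIntersection (embed {n = n} U) (embed W)
embed-trivial {n = n} {U} {W} triv v v∈U v∈W with ∈-embed {n = n} U v∈U | ∈-embed {n = n} W v∈W
... | u , u∈U , refl | w , w∈W , eq =
  trans (cong (𝟎 ++_) (triv u u∈U (subst (_∈ˢ W) (sym (Vec.++-injectiveʳ (𝟎 {n}) 𝟎 eq)) w∈W))) (𝟎-++ n)

embed-graph-trivial : (U : Subspace m k) (B : Vec (F₂^ m) k) → TrivialIntersection (embed U) (graph B)
embed-graph-trivial {m} {k} U B v v∈U v∈B with ∈-embed {n = k} U v∈U | ∈-graph B v∈B
... | w , _ , eq | c , refl with Vec.++-injectiveˡ c (𝟎 {k}) eq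
...   | refl = trans (cong (𝟎 ++_) (lincomb-𝟎 B)) (𝟎-++ k)

-- The first `k` coordinates determine `c`, so a common vector comes from a `c` on which the two
-- linear maps agree.
graph-trivial : (B B′ : Vec (F₂^ m) k) → (∀ c → lincomb c B ≡ lincomb c B′ → c ≡ 𝟎) →
                TrivialIntersection (graph B) (graph B′)
graph-trivial {k = k} B B′ sep v v∈B v∈B′ with ∈-graph B v∈B | ∈-graph B′ v∈B′
... | c , refl | c′ , eq with Vec.++-injectiveˡ c c′ eq
...   | refl with sep c (Vec.++-injectiveʳ c c eq)
...     | refl = trans (cong (𝟎 ++_) (lincomb-𝟎 B)) (𝟎-++ k)

vectors : ∀ n → List (F₂^ n)
vectors zero = [] ∷ []
vectors (suc n) = List.map (false ∷_) (vectors n) List.++ List.map (true ∷_) (vectors n)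

length-vectors : ∀ n → length (vectors n) ≡ 2 ^ n
length-vectors zero = refl
length-vectors (suc n) = begin
  length (vectors (suc n))                              ≡⟨ List.length-++ (List.map (false ∷_) (vectors n)) ⟩
  length (List.map (false ∷_) (vectors n)) + length (List.map (true ∷_) (vectors n))
    ≡⟨ cong₂ _+_ (trans (List.length-map _ (vectors n)) (length-vectors n))
                 (trans (List.length-map _ (vectors n)) (trans (length-vectors n) (sym (+-identityʳ (2 ^ n))))) ⟩
  2 ^ suc n                                             ∎
  where open ≡-Reasoning

vectors-unique : ∀ n → AllPairs _≢_ (vectors n)
vectors-unique zero = [] ∷ []
vectors-unique (suc n) = AllPairs.++⁺ (half false) (half true)
  (All.map⁺ (All.universal (λ u → All.map⁺ (All.universal (λ v ()) (vectors n))) (vectors n)))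
  where
  half : ∀ b → AllPairs _≢_ (List.map (b ∷_) (vectors n))
  half b = AllPairs.map⁺ (AllPairs.map (λ u≢v → u≢v ∘ Vec.∷-injectiveʳ) (vectors-unique n))

-- The recursive construction of the spread

dim : ℕ → ℕ → ℕ
dim k zero = k + 2
dim k (suc t) = k + dim k t

-- In dimension `k + 2` a single element is optimal once `k > 2`, as two would need dimension `2 k`.
-- Each further step adds one graph per vector of `F₂^ (dim k t)`.
spread-size : ℕ → ℕ → ℕ
spread-size k zero = 1
spread-size k (suc t) = spread-size k t + 2 ^ dim k t

k≤dim : ∀ k t → k ≤ dim k t
k≤dim k zero = m≤m+n k 2
k≤dim k (suc t) = m≤m+n k _

-- `1 ≤ m` provides an irreducible polynomial of degree `m`, and `k ≤ m` is the condition of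
-- `powers-separate`.
spread-step : 1 ≤ m → k ≤ m → (S : List (Subspace m k)) → AllPairs TrivialIntersection S →
              ∃ λ (S′ : List (Subspace (k + m) k)) → AllPairs TrivialIntersection S′ × length S′ ≡ length S + 2 ^ m
spread-step {suc m} {k} _ k≤m S ps with exists-irreducible m
... | f , irr , deg-f =
  List.map embed S List.++ List.map (graph ∘ powers irr deg-f k) (vectors (suc m)) ,
  AllPairs.++⁺
    (AllPairs.map⁺ (AllPairs.map (λ {U} {W} → embed-trivial {n = k} {U} {W}) ps))
    (AllPairs.map⁺ (AllPairs.map (λ {a} {b} a≢b → graph-trivial (powers irr deg-f k a) (powers irr deg-f k b) λ c eq →
      [ (λ c≡𝟎 → c≡𝟎) , (λ a≡b → ⊥-elim (a≢b a≡b)) ]′ (powers-separate irr deg-f k≤m c a b eq)) (vectors-unique (suc m))))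
    (All.map⁺ (All.universal (λ U → All.map⁺
      (All.universal (λ a → embed-graph-trivial U (powers irr deg-f k a)) (vectors (suc m)))) S)) ,
  trans (List.length-++ (List.map embed S))
    (cong₂ _+_ (List.length-map embed S) (trans (List.length-map _ (vectors (suc m))) (length-vectors (suc m))))

spread : ∀ k t → 1 ≤ k → ∃ λ (S : List (Subspace (dim k t) k)) → AllPairs TrivialIntersection S × length S ≡ spread-size k t
spread k zero _ = graph (replicate k 𝟎) ∷ [] , [] ∷ [] , refl
spread k (suc t) 1≤k with spread k t 1≤k
... | S , ps , len with spread-step (≤-trans 1≤k (k≤dim k t)) (k≤dim k t) S ps
...   | S′ , ps′ , len′ = S′ , ps′ , trans len′ (cong (_+ 2 ^ dim k t) len)

-- Both bounds combined and the closed formula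

AllPairs⇒IsPartialSpread : {S : List (Subspace n k)} → AllPairs TrivialIntersection S → IsPartialSpread S
AllPairs⇒IsPartialSpread (p ∷ ps) zero zero i≢j = ⊥-elim (i≢j refl)
AllPairs⇒IsPartialSpread (p ∷ ps) zero (suc j) i≢j = All.lookup p (∈-lookup j)
AllPairs⇒IsPartialSpread (p ∷ ps) (suc i) zero i≢j v v∈W v∈U = All.lookup p (∈-lookup i) v v∈U v∈W
AllPairs⇒IsPartialSpread (p ∷ ps) (suc i) (suc j) i≢j = AllPairs⇒IsPartialSpread ps i j (i≢j ∘ cong suc)

IsPartialSpread⇒AllPairs : (S : List (Subspace n k)) → IsPartialSpread S → AllPairs TrivialIntersection S
IsPartialSpread⇒AllPairs S sp =
  subst (AllPairs TrivialIntersection) (List.tabulate-lookup S) (AllPairs.tabulate⁺ (λ {i} {j} → sp i j))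

-- The number of holes with one element more, in the form required by `no-larger-spread`. Solving it
-- for `spread-size k t` gives the closed formula.
spread-size-equation : ∀ k t → 2 ^ dim k t + spread-size k t ≡ suc (spread-size k t) * 2 ^ k + (1 + 2 * 2 ^ k)
spread-size-equation k zero = trans (cong (_+ 1) (^-distribˡ-+-* 2 k 2)) (lem (2 ^ k))
  where
  lem : ∀ K → K * 4 + 1 ≡ 2 * K + (1 + 2 * K)
  lem = solve-∀
spread-size-equation k (suc t) = begin
  2 ^ (k + dim k t) + (s + P)            ≡⟨ cong (_+ (s + P)) (^-distribˡ-+-* 2 k (dim k t)) ⟩
  2 ^ k * P + (s + P)                    ≡⟨ lem (2 ^ k) P s ⟩
  2 ^ k * P + (P + s)                    ≡⟨ cong (2 ^ k * P +_) (spread-size-equation k t) ⟩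
  2 ^ k * P + (suc s * 2 ^ k + (1 + 2 * 2 ^ k))   ≡⟨ lem′ (2 ^ k) P s ⟩
  suc (s + P) * 2 ^ k + (1 + 2 * 2 ^ k)  ∎
  where
  open ≡-Reasoning
  s P : ℕ
  s = spread-size k t
  P = 2 ^ dim k t
  lem : ∀ K P s → K * P + (s + P) ≡ K * P + (P + s)
  lem = solve-∀
  lem′ : ∀ K P s → K * P + (suc s * K + (1 + 2 * K)) ≡ suc (s + P) * K + (1 + 2 * K)
  lem′ = solve-∀

-- All summands but the initial 1 are powers of 2 with exponent at least `k`. This supplies the
-- hypothesis `2 ^ k ∣ m ∸ 1` of `no-larger-spread`.
spread-size-mod : ∀ k t → ∃ λ q → spread-size k t ≡ 1 + q * 2 ^ k
spread-size-mod k zero = 0 , refl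
spread-size-mod k (suc t) with spread-size-mod k t
... | q , eq = q + 2 ^ (dim k t ∸ k) , (begin
  spread-size k t + 2 ^ dim k t                       ≡⟨ cong₂ (λ s d → s + 2 ^ d) eq (sym (m∸n+n≡m (k≤dim k t))) ⟩
  1 + q * 2 ^ k + 2 ^ (dim k t ∸ k + k)               ≡⟨ cong (1 + q * 2 ^ k +_) (^-distribˡ-+-* 2 (dim k t ∸ k) k) ⟩
  1 + q * 2 ^ k + 2 ^ (dim k t ∸ k) * 2 ^ k           ≡⟨ cong suc (*-distribʳ-+ (2 ^ k) q _) ⟨
  1 + (q + 2 ^ (dim k t ∸ k)) * 2 ^ k                 ∎)
  where open ≡-Reasoning

A₂-dim : ∀ k t → 4 ≤ k → A₂≡ (dim k t) k (spread-size k t)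
A₂-dim k t 4≤k = lower , upper
  where
  lower : Σ (List (Subspace (dim k t) k)) λ S → IsPartialSpread S × length S ≡ spread-size k t
  lower = let S , ps , len = spread k t (≤-trans (s≤s z≤n) 4≤k) in S , AllPairs⇒IsPartialSpread ps , len
  upper : ∀ (S : List (Subspace (dim k t) k)) → IsPartialSpread S → length S ≤ spread-size k t
  upper S sp = ≮⇒≥ λ lt → let q , eq = spread-size-mod k t in
    no-larger-spread 4≤k (k≤dim k t) (subst (1 ≤_) (sym eq) (s≤s z≤n)) (divides q (cong (_∸ 1) eq))
      (spread-size-equation k t)
      -- A longer list is cut to exactly one element more than claimed, the length for which the
      -- holes were counted.
      (AllPairs.take⁺ (suc (spread-size k t)) (IsPartialSpread⇒AllPairs S sp))
      (trans (List.length-take (suc (spread-size k t)) S) (m≤n⇒m⊓n≡m lt))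

dim≡ : ∀ k t → dim k t ≡ k * (t + 1) + 2
dim≡ k zero = cong (_+ 2) (sym (*-identityʳ k))
dim≡ k (suc t) = trans (cong (k +_) (dim≡ k t)) (lem k t)
  where
  lem : ∀ k t → k + (k * (t + 1) + 2) ≡ k * (suc t + 1) + 2
  lem = solve-∀

spread-size≡ : ∀ k t .{{_ : NonZero (2 ^ k ∸ 1)}} →
               spread-size k t ≡ (2 ^ (k * (t + 1) + 2) ∸ 3 * 2 ^ k ∸ 1) / (2 ^ k ∸ 1)
spread-size≡ k t = sym (begin
  (2 ^ (k * (t + 1) + 2) ∸ 3 * 2 ^ k ∸ 1) / K   ≡⟨ cong (λ d → (2 ^ d ∸ 3 * 2 ^ k ∸ 1) / K) (dim≡ k t) ⟨
  (2 ^ dim k t ∸ 3 * 2 ^ k ∸ 1) / K             ≡⟨ cong (_/ K) (∸-+-assoc (2 ^ dim k t) (3 * 2 ^ k) 1) ⟩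
  (2 ^ dim k t ∸ (3 * 2 ^ k + 1)) / K           ≡⟨ cong (λ p → (p ∸ (3 * 2 ^ k + 1)) / K) power ⟩
  (s * K + (3 * 2 ^ k + 1) ∸ (3 * 2 ^ k + 1)) / K ≡⟨ cong (_/ K) (m+n∸n≡m (s * K) (3 * 2 ^ k + 1)) ⟩
  s * K / K                                     ≡⟨ m*n/n≡m s K ⟩
  s                                             ∎)
  where
  open ≡-Reasoning
  s K : ℕ
  s = spread-size k t
  K = 2 ^ k ∸ 1
  lem : ∀ s K → suc s * suc K + (1 + 2 * suc K) ≡ s * K + (3 * suc K + 1) + s
  lem = solve-∀
  -- This makes the truncated subtractions in the numerator exact and leaves the multiple `s * K` of
  -- the denominator.
  power : 2 ^ dim k t ≡ s * K + (3 * 2 ^ k + 1)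
  power = +-cancelʳ-≡ s _ _ (trans (spread-size-equation k t)
    (subst (λ p → suc s * p + (1 + 2 * p) ≡ s * K + (3 * p + 1) + s) (m+[n∸m]≡n (m^n>0 2 k)) (lem s K)))

theorem14 : ∀ (t k : ℕ) → 1 ≤ t → (k≥4 : 4 ≤ k) →
    A₂≡ (k * (t + 1) + 2) k
    (_/_ (2 ^ (k * (t + 1) + 2) ∸ 3 * 2 ^ k ∸ 1) (2 ^ k ∸ 1)
    {{pow2∸1-nonZero k (≤-trans (s≤s z≤n) k≥4)}})
theorem14 t k _ k≥4 = subst₂ (λ n m → A₂≡ n k m) (dim≡ k t)
  (spread-size≡ k t {{pow2∸1-nonZero k (≤-trans (s≤s z≤n) k≥4)}}) (A₂-dim k t k≥4)
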